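{- The following hold: (1) $F_2(N)=2N-3$ for every integer $N>2$; (2) $F_3(N)\ge N^2/2-O(N)$, i.e. there is an absolute constant $C$ such that $F_3(N)\ge N^2/2-CN$ for all integers $N>3$; (3) for every integer $k\ge 4$, $F_k(N)=\Omega_k(N^{k-1})$, i.e. there are a constant $c_k>0$ and an integer $N_k$, depending only on $k$, such that $F_k(N)\ge c_kN^{k-1}$ for all $N\ge N_k$.
   Context: For a positive integer $N$ let $[N]=\{1,2,\dots,N\}$, and let $\binom{[N]}{k}$ denote the family of all $k$-element subsets of $[N]$. For sets of integers $A,B$, the sumset is $A+B=\{a+b: a\in A, b\in B\}$. A family $\mathcal A=\{A_i: i\in I\}$ of (distinct) subsets of $\mathbb Z$ is a Sidon system if $A_i+A_j=A_{i'}+A_{j'}$ implies $\{i,j\}=\{i',j'\}$ for all $i,j,i',j'\in I$. For integers $N>k\ge 1$, $F_k(N)$ denotes the largest cardinality of a Sidon system $\mathcal A\subseteq\binom{[N]}{k}$. -}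

module Defs where

open import Data.Bool.Base using (Bool; true; false)
open import Data.Fin.Base using (Fin; zero; suc; toℕ; combine)
open import Data.Fin.Properties using (all?; any?; combine-injective; injective⇒≤)
  renaming (_≟_ to _≟ᶠ_)
open import Data.Fin.Subset as Subset using (Subset; ∣_∣)
open import Data.Fin.Subset.Properties using (anySubset?) renaming (_∈?_ to _∈ˢ?_)
open import Data.Integer.Base as ℤ using (ℤ; +_)
open import Data.Integer.Properties using () renaming (_≟_ to _≟ᶻ_)
open import Data.Nat.Base using (ℕ; zero; suc; _≤_; _^_; s≤s)
open import Data.Nat.Properties using (≤-refl; m≤n⇒m<n∨m≡n; _≟_)
open import Data.Product.Base using (∃; ∃₂; _×_; _,_; proj₁; proj₂)
open import Data.Sum.Base using (inj₁; inj₂)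
open import Data.Vec.Base using (Vec; []; _∷_; lookup; tabulate)
open import Data.Vec.Properties using (lookup∘tabulate)
open import Function.Definitions using (Injective)
open import Level using (0ℓ)
open import Relation.Binary.PropositionalEquality
  using (_≡_; refl; sym; trans; cong; cong₂; subst; subst₂)
open import Relation.Nullary using (¬_; Dec; yes; no; contradiction)
open import Relation.Nullary.Decidable using (map′; _×-dec_; _⊎-dec_; _→-dec_)
open import Relation.Unary using (Pred; Decidable; _∈_; _⊆_; _≐_; _∪_; ｛_｝)

infixl 6 _⊕_

_⊕_ : Pred ℤ 0ℓ → Pred ℤ 0ℓ → Pred ℤ 0ℓ
(A ⊕ B) z = ∃₂ λ a b → a ∈ A × b ∈ B × z ≡ a ℤ.+ b

record IsSidonSystem {I : Set} (A : I → Pred ℤ 0ℓ) : Set where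
  field
    distinct : Injective _≡_ _≐_ A
    sidon    : ∀ i j i′ j′ → A i ⊕ A j ≐ A i′ ⊕ A j′ →
               ｛ i ｝ ∪ ｛ j ｝ ≐ ｛ i′ ｝ ∪ ｛ j′ ｝

-- A subset of [N] = {1,…,N} is encoded by S : Subset N; as Fin N starts at 0,
-- the index x stands for the integer 1 + x.
⟦_⟧ : ∀ {N} → Subset N → Pred ℤ 0ℓ
⟦ S ⟧ z = ∃ λ x → x Subset.∈ S × z ≡ + suc (toℕ x)

-- There is a Sidon system of cardinality m consisting of k-element subsets of
-- [N].  The members are indexed by Fin m; their number is exactly m because a
-- Sidon system has distinct members.
HasSidonSystem : (k N m : ℕ) → Set
HasSidonSystem k N m = ∃ λ (A : Fin m → Subset N) →
  (∀ i → ∣ A i ∣ ≡ k) × IsSidonSystem (λ i → ⟦ A i ⟧)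

IsLargest : Pred ℕ 0ℓ → Pred ℕ 0ℓ
IsLargest P m = P m × (∀ n → P n → n ≤ m)

private
  findLargest : ∀ {P : Pred ℕ 0ℓ} → Decidable P → P 0 →
                 ∀ b → (∀ n → P n → n ≤ b) → ∃ (IsLargest P)
  findLargest P? p₀ zero    bound = 0 , p₀ , bound
  findLargest P? p₀ (suc b) bound with P? (suc b)
  ... | yes p = suc b , p , bound
  ... | no ¬p = findLargest P? p₀ b λ n pn → below n pn (m≤n⇒m<n∨m≡n (bound n pn))
    where
    below : ∀ n → _ → _ → n ≤ b
    below n pn (inj₁ (s≤s n≤b)) = n≤b
    below n pn (inj₂ refl)      = contradiction pn ¬p

  anyVec? : ∀ {N} m {P : Pred (Vec (Subset N) m) 0ℓ} → Decidable P → Dec (∃ P)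
  anyVec? zero    P? = map′ ([] ,_) (λ { ([] , p) → p }) (P? [])
  anyVec? (suc m) P? =
    map′ (λ { (x , xs , p) → x ∷ xs , p }) (λ { (x ∷ xs , p) → x , xs , p })
         (anySubset? λ x → anyVec? m λ xs → P? (x ∷ xs))

  toFin₂ : Bool → Fin 2
  toFin₂ false = zero
  toFin₂ true  = suc zero

  toFin₂-injective : Injective _≡_ _≡_ toFin₂
  toFin₂-injective {false} {false} _ = refl
  toFin₂-injective {true}  {true}  _ = refl

  encode : ∀ {N} → Subset N → Fin (2 ^ N)
  encode []      = zero
  encode (b ∷ S) = combine (toFin₂ b) (encode S)

  encode-injective : ∀ {N} → Injective _≡_ _≡_ (encode {N})
  encode-injective {x = []}    {[]}    _  = refl
  encode-injective {x = b ∷ S} {c ∷ T} eq =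
    let b≡c , S≡T = combine-injective (toFin₂ b) (encode S) (toFin₂ c) (encode T) eq
    in cong₂ _∷_ (toFin₂-injective b≡c) (encode-injective S≡T)

  ≡⇒≐ : {A B : Pred ℤ 0ℓ} → A ≡ B → A ≐ B
  ≡⇒≐ refl = (λ z → z) , (λ z → z)

  size≤ : ∀ k N m → HasSidonSystem k N m → m ≤ 2 ^ N
  size≤ k N m (A , _ , S) = injective⇒≤ {f = λ i → encode (A i)}
    λ eq → IsSidonSystem.distinct S (≡⇒≐ (cong ⟦_⟧ (encode-injective eq)))

  ∈⟦_⟧? : ∀ {N} (S : Subset N) → Decidable ⟦ S ⟧
  ∈⟦ S ⟧? z = any? λ x → (x ∈ˢ? S) ×-dec (z ≟ᶻ + suc (toℕ x))

  ⟦⟧⊆? : ∀ {N} (S : Subset N) {Q : Pred ℤ 0ℓ} → Decidable Q → Dec (⟦ S ⟧ ⊆ Q)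
  ⟦⟧⊆? S Q? = map′ (λ { h (x , x∈S , refl) → h x x∈S }) (λ h x x∈S → h (x , x∈S , refl))
    (all? λ x → (x ∈ˢ? S) →-dec Q? (+ suc (toℕ x)))

  ∈⊕? : ∀ {N} (S T : Subset N) → Decidable (⟦ S ⟧ ⊕ ⟦ T ⟧)
  ∈⊕? S T z =
    map′ (λ { (x , y , x∈S , y∈T , eq) → _ , _ , (x , x∈S , refl) , (y , y∈T , refl) , eq })
         (λ { (_ , _ , (x , x∈S , refl) , (y , y∈T , refl) , eq) → x , y , x∈S , y∈T , eq })
         (any? λ x → any? λ y → (x ∈ˢ? S) ×-dec (y ∈ˢ? T) ×-dec
           (z ≟ᶻ (+ suc (toℕ x) ℤ.+ + suc (toℕ y))))

  ⊕⊆? : ∀ {N} (S T : Subset N) {Q : Pred ℤ 0ℓ} → Decidable Q → Dec (⟦ S ⟧ ⊕ ⟦ T ⟧ ⊆ Q)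
  ⊕⊆? S T Q? =
    map′ (λ { h (_ , _ , (x , x∈S , refl) , (y , y∈T , refl) , refl) → h x y x∈S y∈T })
         (λ h x y x∈S y∈T → h (_ , _ , (x , x∈S , refl) , (y , y∈T , refl) , refl))
         (all? λ x → all? λ y → (x ∈ˢ? S) →-dec ((y ∈ˢ? T) →-dec
           Q? (+ suc (toℕ x) ℤ.+ + suc (toℕ y))))

  pair⊆? : ∀ {m} (i j i′ j′ : Fin m) → Dec (｛ i ｝ ∪ ｛ j ｝ ⊆ ｛ i′ ｝ ∪ ｛ j′ ｝)
  pair⊆? i j i′ j′ = map′ (λ h {x} → h x) (λ h x → h {x})
    (all? λ x → ((i ≟ᶠ x) ⊎-dec (j ≟ᶠ x)) →-dec ((i′ ≟ᶠ x) ⊎-dec (j′ ≟ᶠ x)))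

  isSidonSystem? : ∀ {m N} (A : Fin m → Subset N) → Dec (IsSidonSystem (λ i → ⟦ A i ⟧))
  isSidonSystem? A =
    map′ (λ { (d , s) → record { distinct = λ {i} {j} → d i j ; sidon = s } })
         (λ S → (λ i j → IsSidonSystem.distinct S) , IsSidonSystem.sidon S)
         ((all? λ i → all? λ j →
             (⟦⟧⊆? (A i) ∈⟦ A j ⟧? ×-dec ⟦⟧⊆? (A j) ∈⟦ A i ⟧?) →-dec (i ≟ᶠ j))
          ×-dec
          (all? λ i → all? λ j → all? λ i′ → all? λ j′ →
             (⊕⊆? (A i) (A j) (∈⊕? (A i′) (A j′)) ×-dec ⊕⊆? (A i′) (A j′) (∈⊕? (A i) (A j)))
             →-dec (pair⊆? i j i′ j′ ×-dec pair⊆? i′ j′ i j)))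

  IsSidonSystem-resp : ∀ {m N} {A B : Fin m → Subset N} → (∀ i → A i ≡ B i) →
    IsSidonSystem (λ i → ⟦ A i ⟧) → IsSidonSystem (λ i → ⟦ B i ⟧)
  IsSidonSystem-resp {A = A} {B} A≗B S = record
    { distinct = λ {i} {j} eq → distinct
        (subst₂ (λ X Y → ⟦ X ⟧ ≐ ⟦ Y ⟧) (sym (A≗B i)) (sym (A≗B j)) eq)
    ; sidon = λ i j i′ j′ eq → sidon i j i′ j′
        (subst₂ (λ X Y → X ≐ Y) (sums i j) (sums i′ j′) eq)
    }
    where
    open IsSidonSystem S
    sums : ∀ i j → ⟦ B i ⟧ ⊕ ⟦ B j ⟧ ≡ ⟦ A i ⟧ ⊕ ⟦ A j ⟧
    sums i j = sym (cong₂ (λ X Y → ⟦ X ⟧ ⊕ ⟦ Y ⟧) (A≗B i) (A≗B j))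

  hasSidonSystem? : ∀ k N → Decidable (HasSidonSystem k N)
  hasSidonSystem? k N m =
    map′ (λ { (v , p) → lookup v , p })
         (λ { (A , size , S) → tabulate A ,
              (λ i → trans (cong ∣_∣ (lookup∘tabulate A i)) (size i)) ,
              IsSidonSystem-resp (λ i → sym (lookup∘tabulate A i)) S })
         (anyVec? m λ v → all? (λ i → ∣ lookup v i ∣ ≟ k) ×-dec isSidonSystem? (lookup v))

  hasSidonSystem₀ : ∀ k N → HasSidonSystem k N 0
  hasSidonSystem₀ k N = (λ ()) , (λ ()) , record { distinct = λ { {()} } ; sidon = λ () }

-- Abstract, so that F is characterised by IsLargest alone and is never evaluated
-- by search.
abstract
  largestSidonSystem : ∀ k N → ∃ (IsLargest (HasSidonSystem k N))
  largestSidonSystem k N =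
    findLargest (hasSidonSystem? k N) (hasSidonSystem₀ k N) (2 ^ N) (size≤ k N)

-- Intended for N > k ≥ 1; the maximum exists for all k and N.
F : (k N : ℕ) → ℕ
F k N = proj₁ (largestSidonSystem k N)

{-# OPTIONS --safe #-}

-- k = 2: the sumset of {a , a + d} and {b , b + e} determines exactly a + b and the multiset
-- {d , e}.  Hence no difference between the starts of two members with the same d occurs twice,
-- not even for distinct d, and besides one member for each d there are at most N - 2 others.
-- Taking {1 , 1 + d} and {N - d , N} for every d attains the bound.
--
-- k = 3: all members start at 1.  A coincidence of two sumsets puts each of the nine sums of one
-- side among those of the other side.  Branching over these memberships and eliminating one linear
-- equation per step shows that a nontrivial coincidence involves a translate of {0 , u , u + v} with
-- u = v, v = 2 u or u = 2 v; discarding these costs O(N) of the N² / 2 - O(N) sets.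
--
-- k ≥ 4: fix the minimum and let the i-th other element vary freely in a block at position 3 ^ i.
-- A sum of two powers of 3 determines the powers, so each sum tells which two blocks it comes from,
-- and comparing the sums from blocks i and j recovers the pair of sets.
module Submission where

open import Defs
open import Data.Nat.Base using (ℕ; _<_; _≤_; _*_; _∸_; _^_)
open import Data.Integer.Base using (+_)
open import Data.Rational.Unnormalised.Base as ℚ using (ℚᵘ; 0ℚᵘ; _/_)
open import Data.Product.Base using (_×_; ∃)
open import Relation.Binary.PropositionalEquality using (_≡_)

open import Data.Bool.Base using (Bool; true; false; T; _∨_)
open import Data.Bool.ListAction using (any; all)
open import Data.Bool.Properties using (T-∨; T-≡)
open import Data.Fin.Base using (Fin; zero; suc; toℕ; fromℕ<; finToFun; funToFin; combine)
open import Data.Fin.Patterns using (0F; 1F; 2F; 3F; 4F; 5F; 6F; 7F)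
open import Data.Fin.Properties using (any?; all?; ¬∀⟶∃¬; injective⇒≤; fromℕ<-injective;
  toℕ-fromℕ<; toℕ<n; toℕ≤pred[n]; toℕ-injective; funToFin-finToFin)
open import Data.Fin.Subset as Subset using (Subset; ∣_∣)
open import Data.Fin.Subset.Properties using (∉⊥; ∣⊥∣≡0)
open import Data.Integer.Base as ℤ using (ℤ; -[1+_]; 0ℤ; 1ℤ; -1ℤ)
import Data.Integer.Properties as ℤ
import Data.Integer.Tactic.RingSolver as ℤ using (solve-∀)
open import Data.List.Base using (List; []; _∷_; _++_; map; foldr; length; lookup; filter;
  upTo; allFin; tabulate; cartesianProductWith)
open import Data.List.Membership.Propositional using (_∈_)
open import Data.List.Membership.Propositional.Properties using (∈-lookup; ∈-map⁻; ∈-upTo⁻;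
  ∈-tabulate⁺; ∈-tabulate⁻; ∈-cartesianProductWith⁺; ∈-cartesianProductWith⁻)
open import Data.List.Properties using (filter-all; length-map; length-++; length-upTo; length-tabulate)
open import Data.List.Relation.Binary.Pointwise as Pointwise using (Pointwise; []; _∷_)
open import Data.List.Relation.Binary.Subset.Propositional using (_⊆_)
open import Data.List.Relation.Unary.All as All using (All; []; _∷_)
import Data.List.Relation.Unary.All.Properties as All
open import Data.List.Relation.Unary.AllPairs using ([]; _∷_)
open import Data.List.Relation.Unary.Any using (Any; here; there)
import Data.List.Relation.Unary.Any.Properties as Any
open import Data.List.Relation.Unary.Unique.Propositional using (Unique)
import Data.List.Relation.Unary.Unique.Propositional.Properties as Unique
open import Data.Nat.Base as ℕ using (zero; suc; _+_; z≤n; s≤s; z<s; s≤s⁻¹; NonZero; >-nonZero)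
open import Data.Nat.DivMod using (m<n⇒m%n≡m; [m+kn]%n≡m%n; m*n/n≡m; /-monoˡ-≤; m≡m%n+[m/n]*n; m%n<n; m/n*n≤m)
open import Data.Nat.Induction using (<-wellFounded)
open import Data.Nat.Properties
open import Data.Nat.Tactic.RingSolver using (solve-∀)
open import Data.Product.Base using (_,_; proj₁; proj₂)
open import Data.Product.Properties using (≡-dec)
open import Data.Sum.Base using (_⊎_; inj₁; inj₂; swap)
open import Data.Vec.Base as Vec using (Vec; []; _∷_; zipWith; replicate; here; there)
open import Function.Base using (id; _∘_)
open import Function.Bundles using (_⇔_; mk⇔; Equivalence)
open import Induction.WellFounded using (Acc; acc)
open import Relation.Binary.Definitions using (tri<; tri≈; tri>)
open import Relation.Binary.PropositionalEquality
  using (refl; sym; trans; cong; cong₂; subst; subst₂; _≢_; ≢-sym; _≗_; module ≡-Reasoning)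
open import Relation.Nullary using (¬_; Dec; yes; no; contradiction)
open import Relation.Nullary.Decidable using (_×-dec_; _⊎-dec_; ¬?; decidable-stable)
import Relation.Unary as Unary
open Unary using (Decidable)

-- Subsets of [N] given by lists

insert : ∀ {N} → ℕ → Subset N → Subset N
insert n       []      = []
insert zero    (_ ∷ S) = true ∷ S
insert (suc n) (b ∷ S) = b ∷ insert n S

-- The element n of a list stands for the integer 1 + n, as in ⟦_⟧.
fromList : ∀ {N} → List ℕ → Subset N
fromList = foldr insert Subset.⊥

∈-insert-here : ∀ {N} (x : Fin N) {S} → x Subset.∈ insert (toℕ x) S
∈-insert-here zero    {_ ∷ _} = here
∈-insert-here (suc x) {_ ∷ _} = there (∈-insert-here x)

∈-insert-there : ∀ {N} n {x : Fin N} {S} → x Subset.∈ S → x Subset.∈ insert n S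
∈-insert-there zero    here        = here
∈-insert-there zero    (there x∈S) = there x∈S
∈-insert-there (suc n) here        = here
∈-insert-there (suc n) (there x∈S) = there (∈-insert-there n x∈S)

∈-insert⁻ : ∀ {N} n {x : Fin N} {S} → x Subset.∈ insert n S → toℕ x ≡ n ⊎ x Subset.∈ S
∈-insert⁻ zero    {S = _ ∷ _} here      = inj₁ refl
∈-insert⁻ zero    {S = _ ∷ _} (there p) = inj₂ (there p)
∈-insert⁻ (suc n) {S = _ ∷ _} here      = inj₂ here
∈-insert⁻ (suc n) {S = _ ∷ _} (there p) with ∈-insert⁻ n p
... | inj₁ refl = inj₁ refl
... | inj₂ x∈S  = inj₂ (there x∈S)

∣insert∣ : ∀ {N} (x : Fin N) {S} → x Subset.∉ S → ∣ insert (toℕ x) S ∣ ≡ suc ∣ S ∣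
∣insert∣ zero    {true  ∷ _} x∉S = contradiction here x∉S
∣insert∣ zero    {false ∷ _} x∉S = refl
∣insert∣ (suc x) {true  ∷ _} x∉S = cong suc (∣insert∣ x (x∉S ∘ there))
∣insert∣ (suc x) {false ∷ _} x∉S = ∣insert∣ x (x∉S ∘ there)

∈-fromList : ∀ {N} {x : Fin N} xs → x Subset.∈ fromList xs ⇔ toℕ x ∈ xs
∈-fromList xs = mk⇔ (to xs) from
  where
  to : ∀ xs → _ Subset.∈ fromList xs → _ ∈ xs
  to []       x∈ = contradiction x∈ ∉⊥
  to (n ∷ xs) x∈ with ∈-insert⁻ n x∈
  ... | inj₁ x≡n = here x≡n
  ... | inj₂ x∈′ = there (to xs x∈′)
  from : ∀ {xs} → _ ∈ xs → _ Subset.∈ fromList xs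
  from (here refl)         = ∈-insert-here _
  from {n ∷ _} (there x∈) = ∈-insert-there n (from x∈)

∣fromList∣ : ∀ {N xs} → All (_< N) xs → Unique xs → ∣ fromList {N} xs ∣ ≡ length xs
∣fromList∣ {N} []            []               = ∣⊥∣≡0 N
∣fromList∣ {N} {n ∷ xs} (n<N ∷ xs<N) xs!@(_ ∷ xs!′) = begin
  ∣ insert n (fromList xs) ∣                   ≡⟨ cong (λ n → ∣ insert n (fromList xs) ∣) (toℕ-fromℕ< n<N) ⟨
  ∣ insert (toℕ (fromℕ< n<N)) (fromList xs) ∣  ≡⟨ ∣insert∣ (fromℕ< n<N) n∉xs ⟩
  suc ∣ fromList {N} xs ∣                      ≡⟨ cong suc (∣fromList∣ xs<N xs!′) ⟩
  suc (length xs)                              ∎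
  where
  open ≡-Reasoning
  n∉xs : fromℕ< n<N Subset.∉ fromList xs
  n∉xs n∈xs = Unique.Unique[x∷xs]⇒x∉xs xs!
    (subst (_∈ xs) (toℕ-fromℕ< n<N) (Equivalence.to (∈-fromList xs) n∈xs))

sums : List ℕ → List ℕ → List ℕ
sums = cartesianProductWith _+_

∈⟦fromList⟧ : ∀ {N xs n} → n ∈ xs → n < N → ⟦ fromList {N} xs ⟧ (+ suc n)
∈⟦fromList⟧ {xs = xs} n∈xs n<N = fromℕ< n<N
  , Equivalence.from (∈-fromList xs) (subst (_∈ xs) (sym (toℕ-fromℕ< n<N)) n∈xs)
  , cong (+_ ∘ suc) (sym (toℕ-fromℕ< n<N))

-- A list entry `n` stands for the integer 1 + `n`, so a sum of two entries is shifted by 2.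
∈-sums⇒∈-⊕ : ∀ {N xs ys n} → All (_< N) xs → All (_< N) ys → n ∈ sums xs ys →
             (⟦ fromList {N} xs ⟧ ⊕ ⟦ fromList {N} ys ⟧) (+ (2 + n))
∈-sums⇒∈-⊕ {xs = xs} {ys} xs<N ys<N n∈ with ∈-cartesianProductWith⁻ _+_ xs ys n∈
... | a , b , a∈xs , b∈ys , refl =
  + suc a , + suc b , ∈⟦fromList⟧ a∈xs (All.lookup xs<N a∈xs) , ∈⟦fromList⟧ b∈ys (All.lookup ys<N b∈ys) ,
  cong (+_ ∘ suc) (sym (+-suc a b))

∈-⊕⇒∈-sums : ∀ {N} xs ys {z} → (⟦ fromList {N} xs ⟧ ⊕ ⟦ fromList {N} ys ⟧) z →
             ∃ λ n → n ∈ sums xs ys × z ≡ + (2 + n)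
∈-⊕⇒∈-sums xs ys (_ , _ , (x , x∈ , refl) , (y , y∈ , refl) , refl) =
  toℕ x + toℕ y ,
  ∈-cartesianProductWith⁺ _+_ (Equivalence.to (∈-fromList xs) x∈) (Equivalence.to (∈-fromList ys) y∈) ,
  cong (+_ ∘ suc) (+-suc (toℕ x) (toℕ y))

⊕-⊆⇒sums-⊆ : ∀ {N xs ys} xs′ ys′ → All (_< N) xs → All (_< N) ys →
  ⟦ fromList {N} xs ⟧ ⊕ ⟦ fromList {N} ys ⟧ Unary.⊆ ⟦ fromList {N} xs′ ⟧ ⊕ ⟦ fromList {N} ys′ ⟧ →
  sums xs ys ⊆ sums xs′ ys′
⊕-⊆⇒sums-⊆ xs′ ys′ xs<N ys<N ⊕⊆ n∈ with ∈-⊕⇒∈-sums xs′ ys′ (⊕⊆ (∈-sums⇒∈-⊕ xs<N ys<N n∈))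
... | _ , n′∈ , refl = n′∈

sums-⊆⇒⊕-⊆ : ∀ {N} xs ys {xs′ ys′} → All (_< N) xs′ → All (_< N) ys′ →
  sums xs ys ⊆ sums xs′ ys′ →
  ⟦ fromList {N} xs ⟧ ⊕ ⟦ fromList {N} ys ⟧ Unary.⊆ ⟦ fromList {N} xs′ ⟧ ⊕ ⟦ fromList {N} ys′ ⟧
sums-⊆⇒⊕-⊆ xs ys xs′<N ys′<N sums⊆ z∈ with ∈-⊕⇒∈-sums xs ys z∈
... | _ , n∈ , refl = ∈-sums⇒∈-⊕ xs′<N ys′<N (sums⊆ n∈)

-- Sidon systems given by lists, and lower bounds for `F`

F-attained : ∀ k N → HasSidonSystem k N (F k N)
F-attained k N = proj₁ (proj₂ (largestSidonSystem k N))

F-maximal : ∀ {k N m} → HasSidonSystem k N m → m ≤ F k N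
F-maximal {k} {N} = proj₂ (proj₂ (largestSidonSystem k N)) _

SamePair : ∀ {A : Set} (x y x′ y′ : A) → Set
SamePair x y x′ y′ = x ≡ x′ × y ≡ y′ ⊎ x ≡ y′ × y ≡ x′

record IsMember (k N : ℕ) (xs : List ℕ) : Set where
  constructor member
  field
    bounded : All (_< N) xs
    unique  : Unique xs
    size    : length xs ≡ k

open IsMember

DeterminesPair : ∀ {I : Set} → (I → List ℕ) → (i j i′ j′ : I) → Set
DeterminesPair L i j i′ j′ =
  sums (L i) (L j) ⊆ sums (L i′) (L j′) → sums (L i′) (L j′) ⊆ sums (L i) (L j) → SamePair i j i′ j′

size≤F : ∀ {k N m} (L : Fin m → List ℕ) → (∀ i → IsMember k N (L i)) →
         (∀ i j i′ j′ → DeterminesPair L i j i′ j′) → m ≤ F k N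
size≤F {k} {N} L mem determines = F-maximal
  ( (λ i → fromList (L i))
  , (λ i → trans (∣fromList∣ (bounded (mem i)) (unique (mem i))) (size (mem i)))
  , record
    -- Equal sets have equal doubles, so distinctness is the case of the pairs `i` , `i` and `j` ,
    -- `j`.
    { distinct = λ {i} {j} (to , from) → same (determine i i j j (⊕-mono to , ⊕-mono from))
    ; sidon    = λ i j i′ j′ eq → pairs (determine i j i′ j′ eq)
    } )
  where
  A : _ → Unary.Pred ℤ _
  A i = ⟦ fromList {N} (L i) ⟧
  determine : ∀ i j i′ j′ → A i ⊕ A j Unary.≐ A i′ ⊕ A j′ → SamePair i j i′ j′
  determine i j i′ j′ (to , from) = determines i j i′ j′
    (⊕-⊆⇒sums-⊆ (L i′) (L j′) (bounded (mem i)) (bounded (mem j)) to)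
    (⊕-⊆⇒sums-⊆ (L i) (L j) (bounded (mem i′)) (bounded (mem j′)) from)
  ⊕-mono : ∀ {P Q : Unary.Pred ℤ _} → P Unary.⊆ Q → P ⊕ P Unary.⊆ Q ⊕ Q
  ⊕-mono P⊆Q (a , b , a∈ , b∈ , eq) = a , b , P⊆Q a∈ , P⊆Q b∈ , eq
  same : ∀ {i j} → SamePair i i j j → i ≡ j
  same (inj₁ (i≡j , _)) = i≡j
  same (inj₂ (i≡j , _)) = i≡j
  pairs : ∀ {i j i′ j′} → SamePair i j i′ j′ →
          Unary.｛ i ｝ Unary.∪ Unary.｛ j ｝ Unary.≐ Unary.｛ i′ ｝ Unary.∪ Unary.｛ j′ ｝
  pairs (inj₁ (refl , refl)) = id , id
  pairs (inj₂ (refl , refl)) = swap , swap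

lookup-injective : ∀ {A : Set} {xs : List A} → Unique xs → ∀ i j → lookup xs i ≡ lookup xs j → i ≡ j
lookup-injective (_ ∷ _)     zero    zero    _  = refl
lookup-injective (x∉ ∷ _)    zero    (suc j) eq = contradiction eq (All.lookup x∉ (∈-lookup j))
lookup-injective (x∉ ∷ _)    (suc i) zero    eq = contradiction (sym eq) (All.lookup x∉ (∈-lookup i))
lookup-injective (_ ∷ xs!)   (suc i) (suc j) eq = cong suc (lookup-injective xs! i j eq)

-- The positions of a repetition-free list serve as indices. A lower bound for `F` thus becomes a
-- count of list entries, and such lists can be built by concatenation and filtering.
length≤F : ∀ {k N} {X : Set} (P : X → Set) (L : X → List ℕ) →
  (∀ {x} → P x → IsMember k N (L x)) →
  (∀ {x y x′ y′} → P x → P y → P x′ → P y′ → DeterminesPair L x y x′ y′) →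
  ∀ {xs} → All P xs → Unique xs → length xs ≤ F k N
length≤F P L mem determines {xs} Pxs xs! = size≤F (λ i → L (lookup xs i))
  (λ i → mem (P! i))
  (λ i j i′ j′ to from → pull (determines (P! i) (P! j) (P! i′) (P! j′) to from))
  where
  P! : ∀ i → P (lookup xs i)
  P! i = All.lookup Pxs (∈-lookup i)
  pull : ∀ {i j i′ j′} → SamePair (lookup xs i) (lookup xs j) (lookup xs i′) (lookup xs j′) →
         SamePair i j i′ j′
  pull (inj₁ (p , q)) = inj₁ (lookup-injective xs! _ _ p , lookup-injective xs! _ _ q)
  pull (inj₂ (p , q)) = inj₂ (lookup-injective xs! _ _ p , lookup-injective xs! _ _ q)

-- Two-element sets

Pair : Set
Pair = ℕ × ℕ

-- `d` is one less than the gap, so that every `Pair` gives two different elements.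
pair : Pair → List ℕ
pair (a , d) = a ∷ a + suc d ∷ []

-- The sumset of two pairs whose starts add up to `s`; it depends on the starts only through `s`.
square : (s d e : ℕ) → List ℕ
square s d e = s ∷ s + suc e ∷ s + suc d ∷ s + (suc d + suc e) ∷ []

sums-pair : ∀ a d b e → sums (pair (a , d)) (pair (b , e)) ≡ square (a + b) d e
sums-pair a d b e = cong₂ _∷_ refl (cong₂ _∷_ (lemma₁ a b (suc e)) (cong₂ _∷_ (lemma₂ a b (suc d))
  (cong (_∷ []) (lemma₃ a b (suc d) (suc e)))))
  where
  lemma₁ : ∀ a b v → a + (b + v) ≡ a + b + v
  lemma₁ = solve-∀
  lemma₂ : ∀ a b u → a + u + b ≡ a + b + u
  lemma₂ = solve-∀
  lemma₃ : ∀ a b u v → a + u + (b + v) ≡ a + b + (u + v)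
  lemma₃ = solve-∀

square-min : ∀ s d e → All (s ≤_) (square s d e)
square-min s d e = ≤-refl ∷ m≤m+n s _ ∷ m≤m+n s _ ∷ m≤m+n s _ ∷ []

square-max : ∀ s d e → All (_≤ s + (suc d + suc e)) (square s d e)
square-max s d e = m≤m+n s _ ∷ +-monoʳ-≤ s (m≤n+m (suc e) (suc d)) ∷ +-monoʳ-≤ s (m≤m+n (suc d) (suc e)) ∷ ≤-refl ∷ []

-- The minima give `s`, and then the maxima give the total of the two gaps. The element `s + suc d`
-- lies strictly between minimum and maximum, so `d` is one of `d′` and `e′`, and the total yields
-- the other gap.
square-determines : ∀ {s d e s′ d′ e′} →
  square s d e ⊆ square s′ d′ e′ → square s′ d′ e′ ⊆ square s d e → s ≡ s′ × SamePair d e d′ e′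
square-determines {s} {d} {e} {s′} {d′} {e′} to from
  with refl ← ≤-antisym (All.lookup (square-min s d e) (from (here refl)))
                        (All.lookup (square-min s′ d′ e′) (to (here refl)))
  = refl , same (to (there (there (here refl))))
  where
  total : suc d + suc e ≡ suc d′ + suc e′
  total = +-cancelˡ-≡ s _ _ (≤-antisym
    (All.lookup (square-max s d′ e′) (to (there (there (there (here refl))))))
    (All.lookup (square-max s d e) (from (there (there (there (here refl)))))))
  same : s + suc d ∈ square s d′ e′ → SamePair d e d′ e′
  same (here eq) = contradiction eq (m+1+n≢m s)
  same (there (here eq)) with refl ← +-cancelˡ-≡ s _ _ eq =
    inj₂ (refl , suc-injective (+-cancelˡ-≡ (suc d) _ _ (trans total (+-comm (suc d′) (suc d)))))
  same (there (there (here eq))) with refl ← +-cancelˡ-≡ s _ _ eq =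
    inj₁ (refl , suc-injective (+-cancelˡ-≡ (suc d) _ _ total))
  same (there (there (there (here eq)))) =
    contradiction (sym (trans (+-cancelˡ-≡ s _ _ eq) (sym total))) (m+1+n≢m (suc d))

module ExtremalPairs (n : ℕ) where

  -- With N = 2 + `n`, the bound says that the pair fits into [N], and `a + d ≡ n` that it ends at
  -- N.
  Extremal : Pair → Set
  Extremal (a , d) = a + d ≤ n × (a ≡ 0 ⊎ a + d ≡ n)

  -- For a given gap only two starts are possible. If one start is unchanged, so is the other by
  -- cancellation. If both move in the same direction, the equal sums force the moves to be trivial.
  -- If they move in opposite directions, the sums force `d` and `e` to be equal, and the two pairs
  -- are exchanged.
  starts-determine : ∀ {a b a′ b′ d e} → a ≡ 0 ⊎ a + d ≡ n → b ≡ 0 ⊎ b + e ≡ n →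
    a′ ≡ 0 ⊎ a′ + d ≡ n → b′ ≡ 0 ⊎ b′ + e ≡ n → a + b ≡ a′ + b′ →
    SamePair (a , d) (b , e) (a′ , d) (b′ , e)
  starts-determine {a} {b} {a′} {b′} {d} {e} a! b! a′! b′! eq = go a! b! a′! b′!
    where
    same : a ≡ a′ → SamePair (a , d) (b , e) (a′ , d) (b′ , e)
    same refl = inj₁ (refl , cong (_, e) (+-cancelˡ-≡ a b b′ eq))
    same′ : b ≡ b′ → SamePair (a , d) (b , e) (a′ , d) (b′ , e)
    same′ refl = inj₁ (cong (_, d) (+-cancelʳ-≡ b a a′ eq) , refl)
    go : a ≡ 0 ⊎ a + d ≡ n → b ≡ 0 ⊎ b + e ≡ n → a′ ≡ 0 ⊎ a′ + d ≡ n → b′ ≡ 0 ⊎ b′ + e ≡ n →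
         SamePair (a , d) (b , e) (a′ , d) (b′ , e)
    go (inj₁ a≡0) _ (inj₁ a′≡0) _ = same (trans a≡0 (sym a′≡0))
    go (inj₂ a≡n) _ (inj₂ a′≡n) _ = same (+-cancelʳ-≡ d a a′ (trans a≡n (sym a′≡n)))
    go _ (inj₁ b≡0) _ (inj₁ b′≡0) = same′ (trans b≡0 (sym b′≡0))
    go _ (inj₂ b≡n) _ (inj₂ b′≡n) = same′ (+-cancelʳ-≡ e b b′ (trans b≡n (sym b′≡n)))
    go (inj₁ refl) (inj₁ refl) (inj₂ _) (inj₂ _) = same (sym (m+n≡0⇒m≡0 a′ (sym eq)))
    go (inj₂ _) (inj₂ _) (inj₁ refl) (inj₁ refl) = same (m+n≡0⇒m≡0 a eq)
    go (inj₁ refl) (inj₂ b≡n) (inj₂ a′≡n) (inj₁ refl)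
      with refl ← trans eq (+-identityʳ a′)
      with refl ← +-cancelˡ-≡ b d e (trans a′≡n (sym b≡n)) = inj₂ (refl , refl)
    go (inj₂ a≡n) (inj₁ refl) (inj₁ refl) (inj₂ b′≡n)
      with refl ← trans (sym (+-identityʳ a)) eq
      with refl ← +-cancelˡ-≡ a d e (trans a≡n (sym b′≡n)) = inj₂ (refl , refl)

  pairs-determine : ∀ {p q p′ q′} → Extremal p → Extremal q → Extremal p′ → Extremal q′ →
                    DeterminesPair pair p q p′ q′
  pairs-determine {a , d} {b , e} {a′ , d′} {b′ , e′} (_ , p) (_ , q) (_ , p′) (_ , q′) to from
    with square-determines (subst₂ _⊆_ (sums-pair a d b e) (sums-pair a′ d′ b′ e′) to)
                           (subst₂ _⊆_ (sums-pair a′ d′ b′ e′) (sums-pair a d b e) from)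
  ... | eq , inj₁ (refl , refl) = starts-determine p q p′ q′ eq
  ... | eq , inj₂ (refl , refl) = swap (starts-determine p q q′ p′ (trans eq (+-comm a′ b′)))

  initial final extremal : List Pair
  initial  = map (0 ,_) (upTo (suc n))
  -- The value `d ≡ n` is left out: there the pair ending at N also starts at 0 and is already in
  -- `initial`.
  final    = map (λ d → n ∸ d , d) (upTo n)
  extremal = initial ++ final

  extremal-all : All Extremal extremal
  extremal-all = All.++⁺
    (All.map⁺ (All.map (λ d<1+n → s≤s⁻¹ d<1+n , inj₁ refl) (All.all-upTo (suc n))))
    (All.map⁺ (All.map (λ d<n → ≤-reflexive (m∸n+n≡m (<⇒≤ d<n)) , inj₂ (m∸n+n≡m (<⇒≤ d<n))) (All.all-upTo n)))

  extremal-unique : Unique extremal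
  extremal-unique = Unique.++⁺ (Unique.map⁺ (cong proj₂) (Unique.upTo⁺ (suc n)))
                               (Unique.map⁺ (cong proj₂) (Unique.upTo⁺ n)) disjoint
    where
    disjoint : ∀ {p} → ¬ (p ∈ initial × p ∈ final)
    disjoint (p∈initial , p∈final) with ∈-map⁻ (0 ,_) p∈initial
    ... | _ , _ , refl with ∈-map⁻ (λ d → n ∸ d , d) p∈final
    ... | d , d∈ , eq = <⇒≢ (m<n⇒0<n∸m (∈-upTo⁻ d∈)) (cong proj₁ eq)

  length-extremal : length extremal ≡ suc n + n
  length-extremal = trans (length-++ initial) (cong₂ _+_ (length-map-upTo (0 ,_) (suc n)) (length-map-upTo _ n))
    where
    length-map-upTo : ∀ (f : ℕ → Pair) k → length (map f (upTo k)) ≡ k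
    length-map-upTo f k = trans (length-map f (upTo k)) (length-upTo k)

  lower : suc n + n ≤ F 2 (2 + n)
  lower = subst (_≤ F 2 (2 + n)) length-extremal
    (length≤F Extremal pair
      (λ {(a , d)} (a+d≤n , _) → member
        (s≤s (≤-trans (m≤m+n a d) (m≤n⇒m≤1+n a+d≤n)) ∷ s≤s (≤-trans (≤-reflexive (+-suc a d)) (s≤s a+d≤n)) ∷ [])
        ((≢-sym (m+1+n≢m a) ∷ []) ∷ [] ∷ []) refl)
      (λ p q p′ q′ → pairs-determine p q p′ q′) extremal-all extremal-unique)

-- Upper bound for two-element sets

∣S∣≡0⇒S≡⊥ : ∀ {N} (S : Subset N) → ∣ S ∣ ≡ 0 → S ≡ Subset.⊥
∣S∣≡0⇒S≡⊥ []          _  = refl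
∣S∣≡0⇒S≡⊥ (false ∷ S) eq = cong (false ∷_) (∣S∣≡0⇒S≡⊥ S eq)

∣S∣≡1⇒S≡fromList : ∀ {N} (S : Subset N) → ∣ S ∣ ≡ 1 → ∃ λ a → a < N × S ≡ fromList (a ∷ [])
∣S∣≡1⇒S≡fromList (true ∷ S)  eq = 0 , z<s , cong (true ∷_) (∣S∣≡0⇒S≡⊥ S (suc-injective eq))
∣S∣≡1⇒S≡fromList (false ∷ S) eq with ∣S∣≡1⇒S≡fromList S eq
... | a , a<N , refl = suc a , s≤s a<N , refl

∣S∣≡2⇒S≡pair : ∀ {N} (S : Subset N) → ∣ S ∣ ≡ 2 → ∃ λ ((a , d) : Pair) → a + suc d < N × S ≡ fromList (pair (a , d))
∣S∣≡2⇒S≡pair (true ∷ S)  eq with ∣S∣≡1⇒S≡fromList S (suc-injective eq)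
... | d , d<N , refl = (0 , d) , s≤s d<N , refl
∣S∣≡2⇒S≡pair (false ∷ S) eq with ∣S∣≡2⇒S≡pair S eq
... | (a , d) , a+d<N , refl = (suc a , d) , s≤s a+d<N , refl

module UpperBound {n m} (A : Fin m → Subset (2 + n)) (start gap : Fin m → ℕ)
                  (last<N : ∀ i → start i + suc (gap i) < 2 + n)
                  (A≡ : ∀ i → A i ≡ fromList (pair (start i , gap i)))
                  (A-sidon : IsSidonSystem (λ i → ⟦ A i ⟧)) where

  start+gap≤n : ∀ i → start i + gap i ≤ n
  start+gap≤n i = s≤s⁻¹ (s≤s⁻¹ (subst (_< 2 + n) (+-suc (start i) (gap i)) (last<N i)))

  pair<N : ∀ i → All (_< 2 + n) (pair (start i , gap i))
  pair<N i = ≤-<-trans (m≤m+n (start i) (suc (gap i))) (last<N i) ∷ last<N i ∷ []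

  -- By `sums-pair` a sumset is a function of the sum of the starts and the two gaps.
  ⊕⊆⊕ : ∀ i j i′ j′ → start i + start j ≡ start i′ + start j′ → gap i ≡ gap i′ → gap j ≡ gap j′ →
        ⟦ A i ⟧ ⊕ ⟦ A j ⟧ Unary.⊆ ⟦ A i′ ⟧ ⊕ ⟦ A j′ ⟧
  ⊕⊆⊕ i j i′ j′ s d e = subst₂ Unary._⊆_ (⊕≡ i j) (⊕≡ i′ j′)
    (sums-⊆⇒⊕-⊆ (pair (start i , gap i)) (pair (start j , gap j)) (pair<N i′) (pair<N j′)
      λ {x} → subst (x ∈_) sums≡)
    where
    ⊕≡ : ∀ i j → ⟦ fromList (pair (start i , gap i)) ⟧ ⊕ ⟦ fromList (pair (start j , gap j)) ⟧ ≡ ⟦ A i ⟧ ⊕ ⟦ A j ⟧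
    ⊕≡ i j = cong₂ (λ S T → ⟦ S ⟧ ⊕ ⟦ T ⟧) (sym (A≡ i)) (sym (A≡ j))
    sums≡ : sums (pair (start i , gap i)) (pair (start j , gap j)) ≡
            sums (pair (start i′ , gap i′)) (pair (start j′ , gap j′))
    sums≡ rewrite sums-pair (start i) (gap i) (start j) (gap j)
                | sums-pair (start i′) (gap i′) (start j′) (gap j′) | s | d | e = refl

  same-sum : ∀ i j i′ j′ → start i + start j ≡ start i′ + start j′ → gap i ≡ gap i′ → gap j ≡ gap j′ →
             i′ ≡ i ⊎ j′ ≡ i
  same-sum i j i′ j′ s d e = proj₁ (IsSidonSystem.sidon A-sidon i j i′ j′
    (⊕⊆⊕ i j i′ j′ s d e , ⊕⊆⊕ i′ j′ i j (sym s) (sym d) (sym e))) (inj₁ refl)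

  IsFirst : Fin m → Set
  IsFirst r = ∀ j → gap j ≡ gap r → start r ≤ start j

  first : ∀ i → Acc _<_ (start i) → ∃ λ r → gap i ≡ gap r × IsFirst r
  first i (acc rec) with any? (λ j → (gap j ≟ gap i) ×-dec (start j <? start i))
  ... | no  none = i , refl , λ j same-gap → ≮⇒≥ λ j<i → none (j , same-gap , j<i)
  ... | yes (j , same-gap , j<i) with first j (rec j<i)
  ...   | r , gapⱼ≡ , r-first = r , trans (sym same-gap) gapⱼ≡ , r-first

  -- An injection into the numbers below 2 `n` + 1. The first member with a given gap is coded by
  -- the gap, which is at most `n`. Any other is coded above `n` by its distance from the first
  -- member with its gap; as that distance is between 1 and `n`, one is subtracted from it.
  data Code (i : Fin m) : ℕ → Set where
    isFirst : IsFirst i → Code i (gap i)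
    later   : ∀ r x → gap i ≡ gap r → start i ≡ suc (start r + x) → Code i (suc n + x)

  code : ∀ i → ∃ λ c → c < suc n + n × Code i c
  code i with first i (<-wellFounded (start i))
  ... | r , gapᵢ≡ , r-first with m≤n⇒m<n∨m≡n (r-first i gapᵢ≡)
  ... | inj₂ r≡i = gap i , s≤s (≤-trans (m≤n+m (gap i) (start i)) (≤-trans (start+gap≤n i) (m≤m+n n n))) ,
                   isFirst λ j same-gap → subst (_≤ start j) r≡i (r-first j (trans same-gap gapᵢ≡))
  ... | inj₁ r<i = suc n + x , s≤s (+-monoʳ-< n x<n) , later r x gapᵢ≡ (sym eq)
    where
    x : ℕ
    x = start i ∸ suc (start r)
    eq : suc (start r + x) ≡ start i
    eq = m+[n∸m]≡n r<i
    x<n : x < n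
    x<n = ≤-trans (s≤s (m≤n+m x (start r))) (≤-trans (≤-reflexive eq) (≤-trans (m≤m+n (start i) (gap i)) (start+gap≤n i)))

  gap≢1+n+x : ∀ i x → gap i ≢ suc n + x
  gap≢1+n+x i x = <⇒≢ (s≤s (≤-trans (m≤n+m (gap i) (start i)) (≤-trans (start+gap≤n i) (m≤m+n n x))))

  -- Two first members with equal gaps have equal starts by minimality, hence equal doubles. If `i`
  -- and `j` lie equally far behind their first members `r` and `r′`, then `i` + `r′` and `r` + `j`
  -- have the same sumset, even when the gaps of `i` and `j` differ; since `i` is not `r`, it must
  -- be `j`.
  code-injective : ∀ {i j c c′} → Code i c → Code j c′ → c ≡ c′ → i ≡ j
  code-injective {i} {j} (isFirst i-first) (isFirst j-first) gap≡
    with same-sum i i j j (cong₂ _+_ start≡ start≡) gap≡ gap≡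
    where
    start≡ : start i ≡ start j
    start≡ = ≤-antisym (i-first j (sym gap≡)) (j-first i gap≡)
  ... | inj₁ j≡i = sym j≡i
  ... | inj₂ j≡i = sym j≡i
  code-injective {i} (isFirst _) (later _ x _ _) eq = contradiction eq (gap≢1+n+x i x)
  code-injective {j = j} (later _ x _ _) (isFirst _) eq = contradiction (sym eq) (gap≢1+n+x j x)
  code-injective {i} {j} (later r x gapᵢ startᵢ) (later r′ x′ gapⱼ startⱼ) eq
    with refl ← +-cancelˡ-≡ (suc n) x x′ eq
    with same-sum i r′ r j
           (trans (cong (_+ start r′) startᵢ) (trans (lemma (start r) x (start r′)) (cong (_+_ (start r)) (sym startⱼ))))
           gapᵢ (sym gapⱼ)
    where
    lemma : ∀ a x b → suc (a + x) + b ≡ a + suc (b + x)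
    lemma = solve-∀
  ... | inj₁ refl = contradiction startᵢ (m≢1+m+n (start i))
  ... | inj₂ j≡i  = sym j≡i

  upper : m ≤ suc n + n
  upper = injective⇒≤ {f = λ i → fromℕ< (proj₁ (proj₂ (code i)))} λ {i} {j} eq →
    code-injective (proj₂ (proj₂ (code i))) (proj₂ (proj₂ (code j)))
      (fromℕ<-injective _ _ (proj₁ (proj₂ (code i))) (proj₁ (proj₂ (code j))) eq)

F₂≡2N∸3 : ∀ N → 2 < N → F 2 N ≡ 2 * N ∸ 3
F₂≡2N∸3 (suc zero)    (s≤s ())
F₂≡2N∸3 (suc (suc n)) _ with F-attained 2 (2 + n)
... | A , size , A-sidon = trans (≤-antisym upper (ExtremalPairs.lower n)) (cong (_∸ 3) (lemma n))
  where
  asPair : ∀ i → ∃ λ ((a , d) : Pair) → a + suc d < 2 + n × A i ≡ fromList (pair (a , d))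
  asPair i = ∣S∣≡2⇒S≡pair (A i) (size i)
  upper : F 2 (2 + n) ≤ suc n + n
  upper = UpperBound.upper A (proj₁ ∘ proj₁ ∘ asPair) (proj₂ ∘ proj₁ ∘ asPair)
    (proj₁ ∘ proj₂ ∘ asPair) (proj₂ ∘ proj₂ ∘ asPair) A-sidon
  lemma : ∀ n → 3 + (suc n + n) ≡ 2 * (2 + n)
  lemma = solve-∀

-- Refutation of systems of linear equations in positive variables

Form : ℕ → Set
Form = Vec ℤ

-- The variables take the positive values suc x.
eval : ∀ {n} → Vec ℕ n → Form n → ℤ
eval []      []      = 0ℤ
eval (x ∷ ρ) (c ∷ f) = c ℤ.* + suc x ℤ.+ eval ρ f

linear : ∀ {n} → ℤ → Form n → ℤ → Form n → Form n
linear a f b g = zipWith (λ x y → a ℤ.* x ℤ.+ b ℤ.* y) f g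

_⊞_ _⊖_ : ∀ {n} → Form n → Form n → Form n
f ⊞ g = linear 1ℤ f 1ℤ g
f ⊖ g = linear 1ℤ f -1ℤ g

eval-linear : ∀ {n} (ρ : Vec ℕ n) a f b g →
              eval ρ (linear a f b g) ≡ a ℤ.* eval ρ f ℤ.+ b ℤ.* eval ρ g
eval-linear []      a []      b []      = lemma a b
  where
  lemma : ∀ a b → 0ℤ ≡ a ℤ.* 0ℤ ℤ.+ b ℤ.* 0ℤ
  lemma = ℤ.solve-∀
eval-linear (x ∷ ρ) a (c ∷ f) b (d ∷ g)
  rewrite eval-linear ρ a f b g = lemma a b c d (+ suc x) (eval ρ f) (eval ρ g)
  where
  lemma : ∀ a b c d x y z →
    (a ℤ.* c ℤ.+ b ℤ.* d) ℤ.* x ℤ.+ (a ℤ.* y ℤ.+ b ℤ.* z) ≡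
    a ℤ.* (c ℤ.* x ℤ.+ y) ℤ.+ b ℤ.* (d ℤ.* x ℤ.+ z)
  lemma = ℤ.solve-∀

-- The multipliers k and c such that the leading variable of f cancels in (1 + k) g + c f.
multipliers : ∀ {n} → Form n → Form n → ℕ × ℤ
multipliers []             []      = 0 , 0ℤ
multipliers (+ zero  ∷ f)  (_ ∷ g) = multipliers f g
multipliers (+ suc k ∷ _)  (y ∷ _) = k , ℤ.- y
multipliers (-[1+ k ] ∷ _) (y ∷ _) = k , y

cancel : ∀ {n} → ℕ × ℤ → Form n → Form n → Form n
-- Without anything to cancel, `g` is not scaled, so its coefficients do not grow.
cancel (_ , + zero) f g = g
cancel (k , c)      f g = linear (+ suc k) g c f

eliminate : ∀ {n} → Form n → Form n → Form n
eliminate f g = cancel (multipliers f g) f g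

-- Older equations are applied first: they may contain the leading variable of a newer one, but not
-- conversely, so a cancelled variable does not return.
reduce : ∀ {n} → List (Form n) → Form n → Form n
reduce []       g = g
reduce (f ∷ fs) g = eliminate f (reduce fs g)

-- Tests on the coefficients alone. As the variables are positive, a form without positive
-- coefficients has no positive value.
isNonPositive isZero : ∀ {n} → Form n → Bool
isNonPositive []             = true
isNonPositive (+ zero   ∷ f) = isNonPositive f
isNonPositive (+ suc _  ∷ f) = false
isNonPositive (-[1+ _ ] ∷ f) = isNonPositive f
isZero []             = true
isZero (+ zero   ∷ f) = isZero f
isZero (+ suc _  ∷ f) = false
isZero (-[1+ _ ] ∷ f) = false

Clause : ℕ → Set
Clause n = List (Form n)

closed : ∀ {n} → List (Form n) → List (Clause n) → Bool
closed ps gs = any isNonPositive ps ∨ any (all isZero) gs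

-- Derives a contradiction when all of fs vanish, all of ps are positive, every list in gs has a
-- member that does not vanish, and every list in cs has a member that vanishes.  The forms fs are in
-- echelon form, and ps and gs are reduced modulo fs.
refute : ∀ {n} (fs ps : List (Form n)) (gs cs : List (Clause n)) → Bool
refute fs ps gs []       = closed ps gs
refute fs ps gs (c ∷ cs) = closed ps gs ∨ all branch c
  where
  branch : _ → Bool
  branch g = let f = reduce fs g in
    refute (f ∷ fs) (map (eliminate f) ps) (map (map (eliminate f)) gs) cs

module _ {n} (ρ : Vec ℕ n) where

  Vanishes Positive : Form n → Set
  Vanishes f = eval ρ f ≡ 0ℤ
  Positive f = 0ℤ ℤ.< eval ρ f

  -- The factor in front of `g` is positive, so elimination preserves positivity, and it preserves
  -- vanishing in both directions.
  eval-cancel : ∀ kc f g → Vanishes f → ∃ λ m → eval ρ (cancel kc f g) ≡ + suc m ℤ.* eval ρ g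
  eval-cancel (k , c) f g f≡0 = go c
    where
    scaled : ∀ c → eval ρ (linear (+ suc k) g c f) ≡ + suc k ℤ.* eval ρ g
    scaled c rewrite eval-linear ρ (+ suc k) g c f | f≡0 | ℤ.*-zeroʳ c = ℤ.+-identityʳ _
    go : ∀ c → ∃ λ m → eval ρ (cancel (k , c) f g) ≡ + suc m ℤ.* eval ρ g
    go (+ zero)    = 0 , sym (ℤ.*-identityˡ _)
    go c@(+ suc _) = k , scaled c
    go c@(-[1+ _ ]) = k , scaled c

  module _ {f} (f≡0 : Vanishes f) where

    eliminate-vanishes : ∀ {g} → Vanishes g → Vanishes (eliminate f g)
    eliminate-vanishes {g} g≡0 with eval-cancel (multipliers f g) f g f≡0
    ... | m , eq rewrite g≡0 = trans eq (ℤ.*-zeroʳ (+ suc m))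

    eliminate-vanishes⁻ : ∀ {g} → Vanishes (eliminate f g) → Vanishes g
    eliminate-vanishes⁻ {g} eg≡0 with eval-cancel (multipliers f g) f g f≡0
    ... | m , eq with ℤ.i*j≡0⇒i≡0∨j≡0 (+ suc m) (trans (sym eq) eg≡0)
    ... | inj₂ g≡0 = g≡0

    eliminate-positive : ∀ {g} → Positive g → Positive (eliminate f g)
    eliminate-positive {g} g>0 with eval-cancel (multipliers f g) f g f≡0
    ... | m , eq = subst₂ ℤ._<_ (ℤ.*-zeroʳ (+ suc m)) (sym eq) (ℤ.*-monoˡ-<-pos (+ suc m) g>0)

  reduce-vanishes : ∀ {fs g} → All Vanishes fs → Vanishes g → Vanishes (reduce fs g)
  reduce-vanishes []           g≡0 = g≡0
  reduce-vanishes (f≡0 ∷ fs≡0) g≡0 = eliminate-vanishes f≡0 (reduce-vanishes fs≡0 g≡0)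

isZero-eval : ∀ {n} (ρ : Vec ℕ n) f → T (isZero f) → eval ρ f ≡ 0ℤ
isZero-eval []      []           _ = refl
isZero-eval (x ∷ ρ) (+ zero ∷ f) t = trans (ℤ.+-identityˡ _) (isZero-eval ρ f t)

isNonPositive-eval : ∀ {n} (ρ : Vec ℕ n) f → T (isNonPositive f) → eval ρ f ℤ.≤ 0ℤ
isNonPositive-eval []      []             _ = ℤ.≤-refl
isNonPositive-eval (x ∷ ρ) (+ zero ∷ f)   t = ℤ.+-mono-≤ {x = 0ℤ} ℤ.≤-refl (isNonPositive-eval ρ f t)
isNonPositive-eval (x ∷ ρ) (-[1+ k ] ∷ f) t = ℤ.+-mono-≤ (ℤ.-≤+ {n = 0}) (isNonPositive-eval ρ f t)

module _ {n} (ρ : Vec ℕ n) where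

  Refutable : List (Form n) → List (Clause n) → Set
  Refutable ps gs = All (Positive ρ) ps × All (¬_ ∘ All (Vanishes ρ)) gs

  closed-sound : ∀ {ps gs} → Refutable ps gs → ¬ T (closed ps gs)
  closed-sound {ps} {gs} (ps>0 , gs≢0) t with Equivalence.to (T-∨ {any isNonPositive ps}) t
  ... | inj₁ t₁ = let p>0 , p≤0 = All.lookupAny ps>0 (Any.any⁻ isNonPositive ps t₁) in
    ℤ.<⇒≱ p>0 (isNonPositive-eval ρ _ p≤0)
  ... | inj₂ t₂ = let g≢0 , g≡0 = All.lookupAny gs≢0 (Any.any⁻ (all isZero) gs t₂) in
    g≢0 (All.map (isZero-eval ρ _) (All.all⁺ _ _ g≡0))

  refute-sound : ∀ {fs ps gs cs} → All (Vanishes ρ) fs → Refutable ps gs →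
                 All (Any (Vanishes ρ)) cs → ¬ T (refute fs ps gs cs)
  refute-sound _ st [] t = closed-sound st t
  refute-sound {fs} {ps} {gs} {c ∷ cs} fs≡0 st@(ps>0 , gs≢0) (c≡0 ∷ cs≡0) t
    with Equivalence.to (T-∨ {closed ps gs}) t
  ... | inj₁ t₁ = closed-sound st t₁
  -- All branches are refuted, in particular the one of a member of `c` that vanishes at `ρ`.
  ... | inj₂ t₂ with All.lookupAny (All.all⁺ _ c t₂) c≡0
  ... | t₃ , g≡0 = refute-sound (f≡0 ∷ fs≡0)
      ( All.map⁺ (All.map (eliminate-positive ρ f≡0) ps>0)
      , All.map⁺ (All.map (λ g≢0 → g≢0 ∘ All.map (eliminate-vanishes⁻ ρ f≡0) ∘ All.map⁻) gs≢0) )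
      cs≡0 t₃
    where f≡0 = reduce-vanishes ρ fs≡0 g≡0

  Represents : Form n → ℕ → Set
  Represents f x = eval ρ f ≡ + x

  ⊞-represents : ∀ {f g x y} → Represents f x → Represents g y → Represents (f ⊞ g) (x + y)
  ⊞-represents {f} {g} {x} {y} f≈x g≈y rewrite eval-linear ρ 1ℤ f 1ℤ g | f≈x | g≈y =
    cong₂ ℤ._+_ (ℤ.*-identityˡ (+ x)) (ℤ.*-identityˡ (+ y))

  ⊖-vanishes : ∀ {f g x} → Represents f x → Represents g x → Vanishes ρ (f ⊖ g)
  ⊖-vanishes {f} {g} {x} f≈x g≈x rewrite eval-linear ρ 1ℤ f -1ℤ g | f≈x | g≈x = lemma (+ x)
    where
    lemma : ∀ x → 1ℤ ℤ.* x ℤ.+ -1ℤ ℤ.* x ≡ 0ℤ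
    lemma = ℤ.solve-∀

  ⊖-vanishes⁻ : ∀ {f g x y} → Represents f x → Represents g y → Vanishes ρ (f ⊖ g) → x ≡ y
  ⊖-vanishes⁻ {f} {g} {x} {y} f≈x g≈y f⊖g≡0 rewrite eval-linear ρ 1ℤ f -1ℤ g | f≈x | g≈y =
    ℤ.+-injective (ℤ.i-j≡0⇒i≡j (+ x) (+ y) (trans (lemma (+ x) (+ y)) f⊖g≡0))
    where
    lemma : ∀ x y → x ℤ.- y ≡ 1ℤ ℤ.* x ℤ.+ -1ℤ ℤ.* y
    lemma = ℤ.solve-∀

  sums-represents : ∀ {us vs xs ys} → Pointwise Represents us xs → Pointwise Represents vs ys →
    Pointwise Represents (cartesianProductWith _⊞_ us vs) (cartesianProductWith _+_ xs ys)
  sums-represents []           vs≈ = []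
  sums-represents (u≈x ∷ us≈) vs≈ =
    Pointwise.++⁺ (Pointwise.map⁺ _ _ (Pointwise.map (⊞-represents u≈x) vs≈)) (sums-represents us≈ vs≈)

-- Inclusion of sets as linear conditions: each `u` gives the disjunction of its possible equalities
-- with the members of `vs`.
membership : ∀ {n} → List (Form n) → List (Form n) → List (Clause n)
membership us vs = map (λ u → map (u ⊖_) vs) us

membership-vanishes : ∀ {n} (ρ : Vec ℕ n) {us vs xs ys} →
  Pointwise (Represents ρ) us xs → Pointwise (Represents ρ) vs ys → xs ⊆ ys →
  All (Any (Vanishes ρ)) (membership us vs)
membership-vanishes ρ []                     vs≈ xs⊆ = []
membership-vanishes ρ (_∷_ {x = u} u≈x us≈) vs≈ xs⊆ =
  Any.map⁺ (go vs≈ (xs⊆ (here refl))) ∷ membership-vanishes ρ us≈ vs≈ (xs⊆ ∘ there)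
  where
  go : ∀ {vs ys} → Pointwise (Represents ρ) vs ys → _ ∈ ys → Any (λ v → Vanishes ρ (u ⊖ v)) vs
  go (v≈y ∷ _)  (here refl) = here (⊖-vanishes ρ {u} u≈x v≈y)
  go (_ ∷ vs≈) (there x∈)  = there (go vs≈ x∈)

refuted : ∀ {n} (ρ : Vec ℕ n) {ps gs cs} → All (Positive ρ) ps → All (¬_ ∘ All (Vanishes ρ)) gs →
          refute [] ps gs cs ≡ true → ¬ All (Any (Vanishes ρ)) cs
refuted ρ ps>0 gs≢0 eq cs≡0 = refute-sound ρ [] (ps>0 , gs≢0) cs≡0 (Equivalence.from T-≡ eq)

-- Three-element sets

zeros : ∀ {n} → Form n
zeros = replicate _ 0ℤ

unit : ∀ {n} → Fin n → Form n
unit zero    = 1ℤ ∷ zeros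
unit (suc i) = 0ℤ ∷ unit i

zeros-represents : ∀ {n} (ρ : Vec ℕ n) → Represents ρ zeros 0
zeros-represents []      = refl
zeros-represents (x ∷ ρ) = trans (ℤ.+-identityˡ _) (zeros-represents ρ)

unit-represents : ∀ {n} (ρ : Vec ℕ n) i → Represents ρ (unit i) (suc (Vec.lookup ρ i))
unit-represents (x ∷ ρ) zero    rewrite zeros-represents ρ =
  trans (ℤ.+-identityʳ _) (ℤ.*-identityˡ (+ suc x))
unit-represents (x ∷ ρ) (suc i) = trans (ℤ.+-identityˡ _) (unit-represents ρ i)

Shape : Set
Shape = ℕ × ℕ

-- The order is descending, so that the first entry of a list of sums is the maximum.
triple : Shape → List ℕ
triple (x , y) = suc x + suc y ∷ suc x ∷ 0 ∷ []

-- The gaps of triple (x , y) are u = 1 + x and v = 1 + y.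
record NonDegenerate (s : Shape) : Set where
  constructor nonDegenerate
  field
    u≢v  : proj₁ s ≢ proj₂ s
    v≢2u : 1 + proj₂ s ≢ suc (proj₁ s) + suc (proj₁ s)
    u≢2v : 1 + proj₁ s ≢ suc (proj₂ s) + suc (proj₂ s)

-- The eight variables are the gaps of the four triples, two for each: 0 to 3 belong to the left
-- sumset and 4 to 7 to the right one.
tripleForms : (i j : Fin 8) → List (Form 8)
tripleForms i j = unit i ⊞ unit j ∷ unit i ∷ zeros ∷ []

sumForms : (i j k l : Fin 8) → List (Form 8)
sumForms i j k l = cartesianProductWith _⊞_ (tripleForms i j) (tripleForms k l)

degeneracies : (i j : Fin 8) → List (Clause 8) → List (Clause 8)
degeneracies i j gs =
  (unit i ⊖ unit j ∷ []) ∷ (unit j ⊖ (unit i ⊞ unit i) ∷ []) ∷ (unit i ⊖ (unit j ⊞ unit j) ∷ []) ∷ gs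

differences : (i j k l : Fin 8) → Clause 8
differences i j k l = unit 0F ⊖ unit i ∷ unit 1F ⊖ unit j ∷ unit 2F ⊖ unit k ∷ unit 3F ⊖ unit l ∷ []

-- Alternating the two inclusions puts the equations for both maxima first, which keeps the
-- search tree small.
interleave : {A : Set} → List A → List A → List A
interleave []       ys       = ys
interleave (x ∷ xs) []       = x ∷ xs
interleave (x ∷ xs) (y ∷ ys) = x ∷ y ∷ interleave xs ys

All-interleave : {A : Set} {P : A → Set} {xs ys : List A} → All P xs → All P ys → All P (interleave xs ys)
All-interleave []         pys        = pys
All-interleave (px ∷ pxs) []         = px ∷ pxs
All-interleave (px ∷ pxs) (py ∷ pys) = px ∷ py ∷ All-interleave pxs pys

gaps : List (Form 8)
gaps = map unit (allFin 8)

-- Each list is a conjunction assumed to fail. The first two are the two ways in which the pairs of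
-- triples could agree; the others are the degeneracies of the four triples.
targets : List (Clause 8)
targets = differences 4F 5F 6F 7F ∷ differences 6F 7F 4F 5F ∷
  degeneracies 0F 1F (degeneracies 2F 3F (degeneracies 4F 5F (degeneracies 6F 7F [])))

leftSums rightSums : List (Form 8)
leftSums  = sumForms 0F 1F 2F 3F
rightSums = sumForms 4F 5F 6F 7F

equations : List (Clause 8)
equations = interleave (membership leftSums rightSums) (membership rightSums leftSums)

abstract
  -- The entire case search is run by evaluation here, once; being abstract, it is not repeated
  -- where the result is used.
  refutation : refute [] gaps targets equations ≡ true
  refutation = refl

triples-determine : ∀ {p q p′ q′} → NonDegenerate p → NonDegenerate q → NonDegenerate p′ → NonDegenerate q′ →
                    DeterminesPair triple p q p′ q′
triples-determine {p@(x₁ , y₁)} {q@(x₂ , y₂)} {p′@(x₃ , y₃)} {q′@(x₄ , y₄)} p! q! p′! q′! S⊆S′ S′⊆S =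
  -- Equality of shapes is decidable, so it suffices to refute that the pairs differ.
  decidable-stable same? λ different →
    refuted ρ {gaps} {targets} {equations} gaps>0 (targets≢0 different) refutation
      (All-interleave (membership-vanishes ρ S≈ S′≈ S⊆S′) (membership-vanishes ρ S′≈ S≈ S′⊆S))
  where
  ρ : Vec ℕ 8
  ρ = x₁ ∷ y₁ ∷ x₂ ∷ y₂ ∷ x₃ ∷ y₃ ∷ x₄ ∷ y₄ ∷ []

  _≟ₛ_ : (s t : Shape) → Dec (s ≡ t)
  _≟ₛ_ = ≡-dec _≟_ _≟_

  same? : Dec (SamePair p q p′ q′)
  same? = ((p ≟ₛ p′) ×-dec (q ≟ₛ q′)) ⊎-dec ((p ≟ₛ q′) ×-dec (q ≟ₛ p′))

  triple≈ : ∀ i j → Pointwise (Represents ρ) (tripleForms i j) (triple (Vec.lookup ρ i , Vec.lookup ρ j))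
  triple≈ i j = ⊞-represents ρ {unit i} {unit j} (unit-represents ρ i) (unit-represents ρ j)
    ∷ unit-represents ρ i ∷ zeros-represents ρ ∷ []

  S≈ : Pointwise (Represents ρ) leftSums (sums (triple p) (triple q))
  S≈ = sums-represents ρ (triple≈ 0F 1F) (triple≈ 2F 3F)

  S′≈ : Pointwise (Represents ρ) rightSums (sums (triple p′) (triple q′))
  S′≈ = sums-represents ρ (triple≈ 4F 5F) (triple≈ 6F 7F)

  unit>0 : ∀ i → Positive ρ (unit i)
  unit>0 i = subst (0ℤ ℤ.<_) (sym (unit-represents ρ i)) (ℤ.+<+ z<s)

  gaps>0 : All (Positive ρ) gaps
  gaps>0 = All.map⁺ {f = unit} (All.universal unit>0 (allFin 8))

  unit≡ : ∀ i j → Vanishes ρ (unit i ⊖ unit j) → Vec.lookup ρ i ≡ Vec.lookup ρ j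
  unit≡ i j eq = suc-injective (⊖-vanishes⁻ ρ {unit i} (unit-represents ρ i) (unit-represents ρ j) eq)

  unit≡2unit : ∀ i j → Vanishes ρ (unit i ⊖ (unit j ⊞ unit j)) →
               suc (Vec.lookup ρ i) ≡ suc (Vec.lookup ρ j) + suc (Vec.lookup ρ j)
  unit≡2unit i j = ⊖-vanishes⁻ ρ {unit i} (unit-represents ρ i)
    (⊞-represents ρ {unit j} (unit-represents ρ j) (unit-represents ρ j))

  degeneracies≢0 : ∀ i j {gs} → NonDegenerate (Vec.lookup ρ i , Vec.lookup ρ j) → All (¬_ ∘ All (Vanishes ρ)) gs →
                   All (¬_ ∘ All (Vanishes ρ)) (degeneracies i j gs)
  degeneracies≢0 i j (nonDegenerate u≢v v≢2u u≢2v) gs≢0 =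
    (λ { (eq ∷ []) → u≢v (unit≡ i j eq) }) ∷
    (λ { (eq ∷ []) → v≢2u (unit≡2unit j i eq) }) ∷
    (λ { (eq ∷ []) → u≢2v (unit≡2unit i j eq) }) ∷ gs≢0

  targets≢0 : ¬ SamePair p q p′ q′ → All (¬_ ∘ All (Vanishes ρ)) targets
  targets≢0 different =
    (λ { (a ∷ b ∷ c ∷ d ∷ []) → different (inj₁
      (cong₂ _,_ (unit≡ 0F 4F a) (unit≡ 1F 5F b) , cong₂ _,_ (unit≡ 2F 6F c) (unit≡ 3F 7F d))) }) ∷
    (λ { (a ∷ b ∷ c ∷ d ∷ []) → different (inj₂
      (cong₂ _,_ (unit≡ 0F 6F a) (unit≡ 1F 7F b) , cong₂ _,_ (unit≡ 2F 4F c) (unit≡ 3F 5F d))) }) ∷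
    degeneracies≢0 0F 1F p! (degeneracies≢0 2F 3F q!
      (degeneracies≢0 4F 5F p′! (degeneracies≢0 6F 7F q′! [])))

-- Counting non-degenerate shapes

length-filter-≥ : {A : Set} {P : A → Set} (P? : Decidable P) → (∀ {x y} → ¬ P x → ¬ P y → x ≡ y) →
                  ∀ {xs} → Unique xs → length xs ≤ suc (length (filter P? xs))
length-filter-≥ P? unique-exception [] = z≤n
length-filter-≥ {P = P} P? unique-exception {x ∷ xs} (x∉xs ∷ xs!) with P? x
... | yes px = s≤s (length-filter-≥ P? unique-exception xs!)
-- Once the exception has been met, all later entries differ from it and pass the filter.
... | no ¬px = ≤-reflexive (cong (suc ∘ length) (sym (filter-all P? (All.map rest x∉xs))))
  where
  rest : ∀ {y} → x ≢ y → P y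
  rest {y} x≢y = decidable-stable (P? y) λ ¬py → x≢y (unique-exception ¬px ¬py)

module Row (x : ℕ) where

  P₁ P₂ P₃ : ℕ → Set
  P₁ y = x ≢ y
  P₂ y = suc y ≢ suc x + suc x
  P₃ y = suc x ≢ suc y + suc y

  P₁? : Decidable P₁
  P₁? y = ¬? (x ≟ y)
  P₂? : Decidable P₂
  P₂? y = ¬? (suc y ≟ suc x + suc x)
  P₃? : Decidable P₃
  P₃? y = ¬? (suc x ≟ suc y + suc y)

  row : ℕ → List ℕ
  row n = filter P₁? (filter P₂? (filter P₃? (upTo n)))

  row-unique : ∀ n → Unique (row n)
  row-unique n = Unique.filter⁺ P₁? (Unique.filter⁺ P₂? (Unique.filter⁺ P₃? (Unique.upTo⁺ n)))

  row-all : ∀ n → All (λ y → y < n × NonDegenerate (x , y)) (row n)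
  row-all n = All.zipWith (λ { (y<n , p₁ , p₂ , p₃) → y<n , nonDegenerate p₁ p₂ p₃ })
    ( All.filter⁺ P₁? (All.filter⁺ P₂? (All.filter⁺ P₃? (All.all-upTo n)))
    , All.zip ( All.all-filter P₁? (filter P₂? (filter P₃? (upTo n)))
              , All.zip ( All.filter⁺ P₁? (All.all-filter P₂? (filter P₃? (upTo n)))
                        , All.filter⁺ P₁? (All.filter⁺ P₂? (All.all-filter P₃? (upTo n))))))

  -- For fixed `x` each of the three conditions excludes at most one `y`.
  length-row : ∀ n → n ≤ 3 + length (row n)
  length-row n = begin
    n                                                    ≡⟨ length-upTo n ⟨
    length (upTo n)                                      ≤⟨ length-filter-≥ P₃? P₃-unique (Unique.upTo⁺ n) ⟩
    1 + length (filter P₃? (upTo n))                     ≤⟨ s≤s (length-filter-≥ P₂? P₂-unique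
                                                             (Unique.filter⁺ P₃? (Unique.upTo⁺ n))) ⟩
    2 + length (filter P₂? (filter P₃? (upTo n)))        ≤⟨ s≤s (s≤s (length-filter-≥ P₁? P₁-unique
                                                             (Unique.filter⁺ P₂? (Unique.filter⁺ P₃? (Unique.upTo⁺ n))))) ⟩
    3 + length (row n)                                   ∎
    where
    open ≤-Reasoning
    stable : ∀ {m n : ℕ} → ¬ m ≢ n → m ≡ n
    stable = decidable-stable (_ ≟ _)
    P₁-unique : ∀ {y z} → ¬ P₁ y → ¬ P₁ z → y ≡ z
    P₁-unique p q = trans (sym (stable p)) (stable q)
    P₂-unique : ∀ {y z} → ¬ P₂ y → ¬ P₂ z → y ≡ z
    P₂-unique p q = suc-injective (trans (stable p) (sym (stable q)))
    double-injective : ∀ m n → m + m ≡ n + n → m ≡ n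
    double-injective m n eq = *-cancelˡ-≡ m n 2
      (trans (cong (_+_ m) (+-identityʳ m)) (trans eq (cong (_+_ n) (sym (+-identityʳ n)))))
    P₃-unique : ∀ {y z} → ¬ P₃ y → ¬ P₃ z → y ≡ z
    P₃-unique p q = suc-injective (double-injective _ _ (trans (sym (stable p)) (stable q)))

open Row

-- The triangle `x + y < o + w` with `x ≥ o`, row by row; the row of `o` has `w` places before the
-- degenerate ones are removed.
shapes : (o w : ℕ) → List Shape
shapes o zero    = []
shapes o (suc w) = map (o ,_) (row o (suc w)) ++ shapes (suc o) w

shapes-all : ∀ o w → All (λ (x , y) → o ≤ x × x + y < o + w × NonDegenerate (x , y)) (shapes o w)
shapes-all o zero    = []
shapes-all o (suc w) = All.++⁺
  (All.map⁺ (All.map (λ (y<w , nd) → ≤-refl , +-monoʳ-< o y<w , nd) (row-all o (suc w))))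
  (All.map (λ {s} (o<x , x+y< , nd) → <⇒≤ o<x , subst (proj₁ s + proj₂ s <_) (sym (+-suc o w)) x+y< , nd)
           (shapes-all (suc o) w))

shapes-unique : ∀ o w → Unique (shapes o w)
shapes-unique o zero    = []
shapes-unique o (suc w) = Unique.++⁺ (Unique.map⁺ (cong proj₂) (row-unique o (suc w))) (shapes-unique (suc o) w)
  λ (∈row , ∈shapes) → case-row (∈-map⁻ (o ,_) ∈row) ∈shapes
  where
  case-row : ∀ {s} → (∃ λ y → y ∈ row o (suc w) × s ≡ (o , y)) → ¬ s ∈ shapes (suc o) w
  case-row (_ , _ , refl) s∈ = 1+n≰n (proj₁ (All.lookup (shapes-all (suc o) w) s∈))

-- The triangle has `w * suc w` / 2 places and each of its `w` rows loses at most 3. Doubling avoids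
-- division.
length-shapes : ∀ o w → w * suc w ≤ 2 * length (shapes o w) + 6 * w
length-shapes o zero    = z≤n
length-shapes o (suc w) = begin
  suc w * (2 + w)                              ≡⟨ lemma₁ w ⟩
  w * suc w + 2 * suc w                        ≤⟨ +-mono-≤ (length-shapes (suc o) w) (*-monoʳ-≤ 2 (length-row o (suc w))) ⟩
  (2 * l + 6 * w) + 2 * (3 + r)                ≡⟨ lemma₂ l r w ⟩
  2 * (r + l) + 6 * suc w                      ≡⟨ cong (λ n → 2 * n + 6 * suc w) (sym length≡) ⟩
  2 * length (shapes o (suc w)) + 6 * suc w    ∎
  where
  open ≤-Reasoning
  l = length (shapes (suc o) w)
  r = length (row o (suc w))
  length≡ : length (shapes o (suc w)) ≡ r + l
  length≡ = trans (length-++ (map (o ,_) (row o (suc w)))) (cong (_+ l) (length-map (o ,_) (row o (suc w))))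
  lemma₁ : ∀ w → suc w * (2 + w) ≡ w * suc w + 2 * suc w
  lemma₁ = solve-∀
  lemma₂ : ∀ l r w → (2 * l + 6 * w) + 2 * (3 + r) ≡ 2 * (r + l) + 6 * suc w
  lemma₂ = solve-∀

N²≤2F₃+10N : ∀ N → 3 < N → N * N ≤ 2 * F 3 N + 10 * N
N²≤2F₃+10N (suc zero)    (s≤s ())
N²≤2F₃+10N (suc (suc n)) _ = begin
  N * N                                            ≡⟨ lemma₁ n ⟩
  n * suc n + (3 * n + 4)                          ≤⟨ +-monoˡ-≤ (3 * n + 4) (length-shapes 0 n) ⟩
  2 * length (shapes 0 n) + 6 * n + (3 * n + 4)    ≤⟨ +-monoˡ-≤ (3 * n + 4) (+-monoˡ-≤ (6 * n) (*-monoʳ-≤ 2 bound)) ⟩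
  -- The error terms add up to 9 `n` + 4, and `n + 16` completes them to 10 `N` with `N` = 2 + `n`.
  2 * F 3 N + 6 * n + (3 * n + 4)                  ≤⟨ m≤m+n _ (n + 16) ⟩
  2 * F 3 N + 6 * n + (3 * n + 4) + (n + 16)       ≡⟨ lemma₂ (F 3 N) n ⟩
  2 * F 3 N + 10 * N                               ∎
  where
  open ≤-Reasoning
  N = 2 + n
  lemma₁ : ∀ n → (2 + n) * (2 + n) ≡ n * suc n + (3 * n + 4)
  lemma₁ = solve-∀
  lemma₂ : ∀ F n → 2 * F + 6 * n + (3 * n + 4) + (n + 16) ≡ 2 * F + 10 * (2 + n)
  lemma₂ = solve-∀
  bound : length (shapes 0 n) ≤ F 3 N
  bound = length≤F (λ (x , y) → x + y < n × NonDegenerate (x , y)) triple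
    (λ {(x , y)} (x+y<n , _) → member
      ( s≤s (s≤s (≤-trans (≤-reflexive (+-suc x y)) x+y<n))
      ∷ s≤s (s≤s (≤-trans (m≤m+n x y) (<⇒≤ x+y<n))) ∷ z<s ∷ [])
      ((m+1+n≢m (suc x) ∷ (λ ()) ∷ []) ∷ ((λ ()) ∷ []) ∷ [] ∷ [])
      refl)
    (λ (_ , p) (_ , q) (_ , p′) (_ , q′) → triples-determine p q p′ q′)
    (All.map proj₂ (shapes-all 0 n)) (shapes-unique 0 n)

-- Larger sets

-- The larger exponent decides: in base 3 even two copies of `3 ^ j` stay below `3 ^ suc j`.
pow3-sum-< : ∀ {i j} i′ {j′} → i ≤ j → j < j′ → 3 ^ i + 3 ^ j < 3 ^ i′ + 3 ^ j′
pow3-sum-< {i} {j} i′ {j′} i≤j j<j′ = begin-strict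
  3 ^ i + 3 ^ j              ≤⟨ +-monoˡ-≤ (3 ^ j) (^-monoʳ-≤ 3 i≤j) ⟩
  3 ^ j + 3 ^ j              <⟨ m<m+n (3 ^ j + 3 ^ j) (m^n>0 3 j) ⟩
  3 ^ j + 3 ^ j + 3 ^ j      ≡⟨ lemma (3 ^ j) ⟩
  3 ^ suc j                  ≤⟨ ^-monoʳ-≤ 3 j<j′ ⟩
  3 ^ j′                     ≤⟨ m≤n+m (3 ^ j′) (3 ^ i′) ⟩
  3 ^ i′ + 3 ^ j′            ∎
  where
  open ≤-Reasoning
  lemma : ∀ x → x + x + x ≡ 3 * x
  lemma = solve-∀

pow3-injective : ∀ {i j} → 3 ^ i ≡ 3 ^ j → i ≡ j
pow3-injective {i} {j} eq with <-cmp i j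
... | tri< i<j _ _ = contradiction eq (<⇒≢ (^-monoʳ-< 3 (s≤s (s≤s z≤n)) i<j))
... | tri≈ _ i≡j _ = i≡j
... | tri> _ _ j<i = contradiction (sym eq) (<⇒≢ (^-monoʳ-< 3 (s≤s (s≤s z≤n)) j<i))

pow3-sum-ordered : ∀ {i j i′ j′} → i ≤ j → i′ ≤ j′ → 3 ^ i + 3 ^ j ≡ 3 ^ i′ + 3 ^ j′ → i ≡ i′ × j ≡ j′
pow3-sum-ordered {i} {j} {i′} {j′} i≤j i′≤j′ eq with <-cmp j j′
... | tri< j<j′ _ _ = contradiction eq (<⇒≢ (pow3-sum-< i′ i≤j j<j′))
... | tri≈ _ refl _ = pow3-injective (+-cancelʳ-≡ (3 ^ j) (3 ^ i) (3 ^ i′) eq) , refl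
... | tri> _ _ j′<j = contradiction (sym eq) (<⇒≢ (pow3-sum-< i i′≤j′ j′<j))

pow3-sum-determines : ∀ i j i′ j′ → 3 ^ i + 3 ^ j ≡ 3 ^ i′ + 3 ^ j′ → SamePair i j i′ j′
pow3-sum-determines i j i′ j′ eq with ≤-total i j | ≤-total i′ j′
... | inj₁ i≤j | inj₁ i′≤j′ = inj₁ (pow3-sum-ordered i≤j i′≤j′ eq)
... | inj₁ i≤j | inj₂ j′≤i′ = inj₂ (pow3-sum-ordered i≤j j′≤i′ (trans eq (+-comm (3 ^ i′) (3 ^ j′))))
... | inj₂ j≤i | inj₁ i′≤j′ with pow3-sum-ordered j≤i i′≤j′ (trans (+-comm (3 ^ j) (3 ^ i)) eq)
...   | j≡i′ , i≡j′ = inj₂ (i≡j′ , j≡i′)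
pow3-sum-determines i j i′ j′ eq | inj₂ j≤i | inj₂ j′≤i′
  with pow3-sum-ordered j≤i j′≤i′ (trans (+-comm (3 ^ j) (3 ^ i)) (trans eq (+-comm (3 ^ i′) (3 ^ j′))))
...   | j≡j′ , i≡i′ = inj₁ (i≡i′ , j≡j′)

%-/-unique : ∀ {w} q q′ {r r′} → r < w → r′ < w → r + q * w ≡ r′ + q′ * w → q ≡ q′ × r ≡ r′
%-/-unique {w@(suc _)} q q′ {r} {r′} r<w r′<w eq =
  *-cancelʳ-≡ q q′ w (+-cancelˡ-≡ r′ (q * w) (q′ * w) (trans (cong (_+ q * w) (sym r≡r′)) eq)) , r≡r′
  where
  open ≡-Reasoning
  r≡r′ : r ≡ r′
  r≡r′ = begin
    r                   ≡⟨ m<n⇒m%n≡m r<w ⟨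
    r ℕ.% w             ≡⟨ [m+kn]%n≡m%n r q w ⟨
    (r + q * w) ℕ.% w   ≡⟨ cong (ℕ._% w) eq ⟩
    (r′ + q′ * w) ℕ.% w ≡⟨ [m+kn]%n≡m%n r′ q′ w ⟩
    r′ ℕ.% w            ≡⟨ m<n⇒m%n≡m r′<w ⟩
    r′                  ∎

-- Recovering two functions from their cross sums

SameFunctions : ∀ {n} (a b a′ b′ : Fin n → ℕ) → Set
SameFunctions a b a′ b′ = (a ≗ a′ × b ≗ b′) ⊎ (a ≗ b′ × b ≗ a′)

module _ {n} {a b a′ b′ : Fin (suc n) → ℕ}
         (b₀ : b zero ≡ 0) (a′₀ : a′ zero ≡ 0) (b′₀ : b′ zero ≡ 0)
         (cross : ∀ i j → a i + b j ≡ a′ i + b′ j ⊎ a i + b j ≡ a′ j + b′ i) where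

  private
    diagonal : ∀ i → a i + b i ≡ a′ i + b′ i
    diagonal i with cross i i
    ... | inj₁ eq = eq
    ... | inj₂ eq = eq

    -- At index zero `b`, `a′` and `b′` vanish, so crossing `i` with zero finds `a i` among `a′ i`
    -- and `b′ i`; the diagonal then gives `b i`.
    choice : ∀ i → (a i ≡ a′ i × b i ≡ b′ i) ⊎ (a i ≡ b′ i × b i ≡ a′ i)
    choice i with cross i zero
    ... | inj₁ eq rewrite b₀ | b′₀ | +-identityʳ (a i) | +-identityʳ (a′ i) =
      inj₁ (eq , +-cancelˡ-≡ (a i) _ _ (trans (diagonal i) (cong (_+ b′ i) (sym eq))))
    ... | inj₂ eq rewrite b₀ | a′₀ | +-identityʳ (a i) =
      inj₂ (eq , +-cancelˡ-≡ (a i) _ _ (trans (diagonal i)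
        (trans (+-comm (a′ i) (b′ i)) (cong (_+ a′ i) (sym eq)))))

    -- If a and a′ differ at i, then there a = b′ and b = a′, and comparing every j with i
    -- shows that the exchange happens at j as well.
    exchanged : ∀ i → a i ≢ a′ i → ∀ j → a j ≡ b′ j × b j ≡ a′ j
    exchanged i aᵢ≢a′ᵢ j with choice i | choice j
    ... | inj₁ (aᵢ≡a′ᵢ , _) | _         = contradiction aᵢ≡a′ᵢ aᵢ≢a′ᵢ
    ... | inj₂ _            | inj₂ swapped = swapped
    ... | inj₂ (aᵢ≡b′ᵢ , _) | inj₁ (aⱼ≡a′ⱼ , bⱼ≡b′ⱼ) with cross i j
    ...   | inj₁ eq = contradiction (+-cancelʳ-≡ (b′ j) (a i) (a′ i) (trans (cong (_+_ (a i)) (sym bⱼ≡b′ⱼ)) eq)) aᵢ≢a′ᵢ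
    -- Here `a′` and `b′` agree at `j`, so the unexchanged equations at `j` are also the exchanged
    -- ones.
    ...   | inj₂ eq = trans aⱼ≡a′ⱼ a′ⱼ≡b′ⱼ , trans bⱼ≡b′ⱼ (sym a′ⱼ≡b′ⱼ)
      where
      a′ⱼ≡b′ⱼ : a′ j ≡ b′ j
      a′ⱼ≡b′ⱼ = +-cancelʳ-≡ (b′ i) (a′ j) (b′ j)
        (trans (sym eq) (trans (cong₂ _+_ aᵢ≡b′ᵢ bⱼ≡b′ⱼ) (+-comm (b′ i) (b′ j))))

  cross-sums-determine : SameFunctions a b a′ b′
  cross-sums-determine with all? (λ i → a i ≟ a′ i)
  ... | yes a≗a′ = inj₁ (a≗a′ , λ i → +-cancelˡ-≡ (a i) _ _ (trans (diagonal i) (cong (_+ b′ i) (sym (a≗a′ i)))))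
  ... | no  a≢a′ with ¬∀⟶∃¬ _ _ (λ i → a i ≟ a′ i) a≢a′
  ...   | i , aᵢ≢a′ᵢ = inj₂ ((proj₁ ∘ exchanged i aᵢ≢a′ᵢ) , (proj₂ ∘ exchanged i aᵢ≢a′ᵢ))

funToFin-cong : ∀ {m n} {f g : Fin m → Fin n} → f ≗ g → funToFin f ≡ funToFin g
funToFin-cong {zero}  f≗g = refl
funToFin-cong {suc m} f≗g = cong₂ combine (f≗g zero) (funToFin-cong (f≗g ∘ suc))

finToFun-injective : ∀ {m n} (s t : Fin (m ^ n)) → finToFun {m} {n} s ≗ finToFun t → s ≡ t
finToFun-injective {m} {n} s t eq =
  trans (sym (funToFin-finToFin {n} {m} s)) (trans (funToFin-cong eq) (funToFin-finToFin {n} {m} t))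

-- Sets with one element in each block

module Blocks (K M : ℕ) where

  -- `t` codes `K` free digits below `M`. The digit at zero is fixed, which makes the minimum common
  -- to all sets and meets the hypotheses of `cross-sums-determine`.
  digit : Fin (M ^ K) → Fin (suc K) → ℕ
  digit t zero    = 0
  digit t (suc i) = toℕ (finToFun t i)

  digit≤M : ∀ t i → digit t i ≤ M
  digit≤M t zero    = z≤n
  digit≤M t (suc i) = <⇒≤ (toℕ<n (finToFun t i))

  digit-injective : ∀ {s t} → digit s ≗ digit t → s ≡ t
  digit-injective {s} {t} eq = finToFun-injective {M} {K} s t (toℕ-injective ∘ eq ∘ suc)

  -- Larger than any sum of two digits, so adding two elements produces no carry into the multiple
  -- of `width`.
  width : ℕ
  width = suc (M + M)

  element : Fin (M ^ K) → Fin (suc K) → ℕ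
  element t i = digit t i + 3 ^ toℕ i * width

  elements : Fin (M ^ K) → List ℕ
  elements t = tabulate (element t)

  digits<width : ∀ s t i j → digit s i + digit t j < width
  digits<width s t i j = s≤s (+-mono-≤ (digit≤M s i) (digit≤M t j))

  element-injective : ∀ t {i j} → element t i ≡ element t j → i ≡ j
  element-injective t {i} {j} eq = toℕ-injective (pow3-injective
    (proj₁ (%-/-unique (3 ^ toℕ i) (3 ^ toℕ j) (s≤s (≤-trans (digit≤M t i) (m≤m+n M M)))
                       (s≤s (≤-trans (digit≤M t j) (m≤m+n M M))) eq)))

  element+element : ∀ s t i j →
    element s i + element t j ≡ (digit s i + digit t j) + (3 ^ toℕ i + 3 ^ toℕ j) * width
  element+element s t i j = lemma (digit s i) (digit t j) (3 ^ toℕ i) (3 ^ toℕ j) width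
    where
    lemma : ∀ a b c d w → (a + c * w) + (b + d * w) ≡ (a + b) + (c + d) * w
    lemma = solve-∀

  module _ {s t s′ t′} (S⊆S′ : sums (elements s) (elements t) ⊆ sums (elements s′) (elements t′)) where

    -- Division by `width` splits a sum of two elements: the quotient is a sum of two powers of 3
    -- and identifies the blocks up to order, and the remainder is the sum of the digits.
    cross : ∀ i j → digit s i + digit t j ≡ digit s′ i + digit t′ j
                  ⊎ digit s i + digit t j ≡ digit s′ j + digit t′ i
    cross i j with ∈-cartesianProductWith⁻ _+_ (elements s′) (elements t′)
      (S⊆S′ (∈-cartesianProductWith⁺ _+_ (∈-tabulate⁺ {f = element s} i) (∈-tabulate⁺ {f = element t} j)))
    ... | x , y , x∈ , y∈ , eq with ∈-tabulate⁻ {f = element s′} x∈ | ∈-tabulate⁻ {f = element t′} y∈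
    ... | i′ , refl | j′ , refl with %-/-unique (3 ^ toℕ i + 3 ^ toℕ j) (3 ^ toℕ i′ + 3 ^ toℕ j′)
      (digits<width s t i j) (digits<width s′ t′ i′ j′)
      (trans (sym (element+element s t i j)) (trans eq (element+element s′ t′ i′ j′)))
    ... | powers≡ , digits≡ with pow3-sum-determines (toℕ i) (toℕ j) (toℕ i′) (toℕ j′) powers≡
    ... | inj₁ (p , q) rewrite toℕ-injective p | toℕ-injective q = inj₁ digits≡
    ... | inj₂ (p , q) rewrite toℕ-injective p | toℕ-injective q = inj₂ digits≡

    elements-determine : SamePair s t s′ t′
    elements-determine with cross-sums-determine refl refl refl cross
    ... | inj₁ (p , q) = inj₁ (digit-injective p , digit-injective q)
    ... | inj₂ (p , q) = inj₂ (digit-injective p , digit-injective q)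

  M^K≤F : ∀ {N} → M + 3 ^ K * width < N → M ^ K ≤ F (suc K) N
  M^K≤F {N} M+3^Kw<N = size≤F elements
    (λ t → member (All.tabulate⁺ (element<N t)) (Unique.tabulate⁺ (element-injective t)) (length-tabulate (element t)))
    (λ _ _ _ _ S⊆S′ _ → elements-determine S⊆S′)
    where
    element<N : ∀ t i → element t i < N
    element<N t i = ≤-<-trans
      (+-mono-≤ (digit≤M t i) (*-monoˡ-≤ width (^-monoʳ-≤ 3 (toℕ≤pred[n] i)))) M+3^Kw<N

-- Choosing the number of digits for given N

^-distribʳ-* : ∀ k m n → (m * n) ^ k ≡ m ^ k * n ^ k
^-distribʳ-* zero    m n = refl
^-distribʳ-* (suc k) m n = trans (cong (m * n *_) (^-distribʳ-* k m n)) (lemma m n (m ^ k) (n ^ k))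
  where
  lemma : ∀ m n x y → m * n * (x * y) ≡ m * x * (n * y)
  lemma = solve-∀

module LowerBound (K : ℕ) where

  -- Blocks of width 1 + 2 M at positions up to 3 ^ K fit into [D M] as soon as M ≥ 2.
  D : ℕ
  D = 4 * 3 ^ K

  instance
    D≢0 : NonZero D
    D≢0 = m*n≢0 4 (3 ^ K) {{_}} {{m^n≢0 3 K}}

    [2D]^K≢0 : NonZero ((2 * D) ^ K)
    [2D]^K≢0 = m^n≢0 (2 * D) K {{m*n≢0 2 D}}

  -- Take for `M` the integer part of `N` / `D`. Then `M` ≥ 2, and `N` ≤ `D` + `D` `M` ≤ 2 `D` `M`,
  -- so that `M ^ K` falls short of `N ^ K` by at most the constant factor `(2 * D) ^ K`.
  N^K≤[2D]^K*F : ∀ N → 2 * D ≤ N → N ^ K ≤ (2 * D) ^ K * F (suc K) N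
  N^K≤[2D]^K*F N 2D≤N = begin
    N ^ K                          ≤⟨ ^-monoˡ-≤ K N≤2DM ⟩
    (2 * D * M) ^ K                ≡⟨ ^-distribʳ-* K (2 * D) M ⟩
    (2 * D) ^ K * M ^ K            ≤⟨ *-monoʳ-≤ ((2 * D) ^ K) (Blocks.M^K≤F K M fits) ⟩
    (2 * D) ^ K * F (suc K) N      ∎
    where
    open ≤-Reasoning
    M = N ℕ./ D
    2≤M : 2 ≤ M
    2≤M = subst (_≤ M) (m*n/n≡m 2 D) (/-monoˡ-≤ D 2D≤N)
    N≤2DM : N ≤ 2 * D * M
    N≤2DM = begin
      N                  ≡⟨ m≡m%n+[m/n]*n N D ⟩
      N ℕ.% D + M * D    ≤⟨ +-monoˡ-≤ (M * D) (<⇒≤ (m%n<n N D)) ⟩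
      D + M * D          ≤⟨ +-monoˡ-≤ (M * D) (m≤n*m D M {{>-nonZero (≤-trans (s≤s z≤n) 2≤M)}}) ⟩
      M * D + M * D      ≡⟨ lemma M D ⟩
      2 * D * M          ∎
      where
      lemma : ∀ M D → M * D + M * D ≡ 2 * D * M
      lemma = solve-∀
    fits : M + 3 ^ K * suc (M + M) < N
    fits = begin-strict
      M + 3 ^ K * suc (M + M)                   ≡⟨ lemma₁ M (3 ^ K) ⟩
      -- The bound `M` ≥ 2 makes the last step strict: it absorbs the extra 1 in the block width.
      M * 1 + (2 * 3 ^ K * M + 3 ^ K * 1)       <⟨ +-mono-≤-< (*-monoʳ-≤ M (m^n>0 3 K))
                                                   (+-monoʳ-< (2 * 3 ^ K * M) (*-monoʳ-< (3 ^ K) {{m^n≢0 3 K}} 2≤M)) ⟩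
      M * 3 ^ K + (2 * 3 ^ K * M + 3 ^ K * M)   ≡⟨ lemma₂ M (3 ^ K) ⟩
      M * D                                     ≤⟨ m/n*n≤m N D ⟩
      N                                         ∎
      where
      lemma₁ : ∀ M t → M + t * suc (M + M) ≡ M * 1 + (2 * t * M + t * 1)
      lemma₁ = solve-∀
      lemma₂ : ∀ M t → M * t + (2 * t * M + t * M) ≡ M * (4 * t)
      lemma₂ = solve-∀

-- The bounds as rational inequalities

N²/2-CN≤F₃ : ∀ N → 3 < N → (+ (N ^ 2) / 2) ℚ.- (+ 5 / 1 ℚ.* (+ N / 1)) ℚ.≤ + F 3 N / 1
N²/2-CN≤F₃ N 3<N = ℚ.*≤* (begin
  -- Clearing denominators doubles the inequality, so the constant 5 turns into the 10 of
  -- `N²≤2F₃+10N`.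
  (+ (N ^ 2) ℤ.* + 1 ℤ.+ ℤ.- (+ 5 ℤ.* + N) ℤ.* + 2) ℤ.* + 1   ≡⟨ lemma₁ (+ (N ^ 2)) (+ N) ⟩
  + (N ^ 2) ℤ.- + 10 ℤ.* + N                                  ≡⟨ casts ⟩
  + (N * N) ℤ.- + (10 * N)                                    ≤⟨ ℤ.+-monoˡ-≤ (ℤ.- + (10 * N)) (ℤ.+≤+ (N²≤2F₃+10N N 3<N)) ⟩
  + (2 * F 3 N) ℤ.+ + (10 * N) ℤ.- + (10 * N)                 ≡⟨ lemma₂ (+ (2 * F 3 N)) (+ (10 * N)) ⟩
  + (2 * F 3 N)                                               ≡⟨ cong +_ (*-comm 2 (F 3 N)) ⟩
  + (F 3 N * 2)                                               ≡⟨ ℤ.pos-* (F 3 N) 2 ⟩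
  + F 3 N ℤ.* + 2                                             ∎)
  where
  open ℤ.≤-Reasoning
  lemma₁ : ∀ x y → (x ℤ.* + 1 ℤ.+ ℤ.- (+ 5 ℤ.* y) ℤ.* + 2) ℤ.* + 1 ≡ x ℤ.- + 10 ℤ.* y
  lemma₁ = ℤ.solve-∀
  lemma₂ : ∀ x y → x ℤ.+ y ℤ.- y ≡ x
  lemma₂ = ℤ.solve-∀
  casts : + (N ^ 2) ℤ.- + 10 ℤ.* + N ≡ + (N * N) ℤ.- + (10 * N)
  casts rewrite ℤ.pos-* 10 N | *-identityʳ N = refl

a≤m*b⇒a/m≤b : ∀ {a b} m .{{_ : NonZero m}} → a ≤ m * b → (+ 1 / m) ℚ.* (+ a / 1) ℚ.≤ + b / 1
a≤m*b⇒a/m≤b {a} {b} m@(suc _) a≤mb = ℚ.*≤* (begin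
  + 1 ℤ.* + a ℤ.* + 1     ≡⟨ lemma (+ a) ⟩
  + a                     ≤⟨ ℤ.+≤+ a≤mb ⟩
  + (m * b)               ≡⟨ cong +_ (trans (*-comm m b) (cong (b *_) (sym (*-identityʳ m)))) ⟩
  + (b * (m * 1))         ≡⟨ ℤ.pos-* b (m * 1) ⟩
  + b ℤ.* + (m * 1)       ∎)
  where
  open ℤ.≤-Reasoning
  lemma : ∀ x → + 1 ℤ.* x ℤ.* + 1 ≡ x
  lemma = ℤ.solve-∀

0<1/m : ∀ m .{{_ : NonZero m}} → 0ℚᵘ ℚ.< + 1 / m
0<1/m (suc _) = ℚ.*<* (ℤ.+<+ z<s)

theorem1p4 : (∀ N → 2 < N → F 2 N ≡ 2 * N ∸ 3)
    × (∃ λ (C : ℚᵘ) → ∀ N → 3 < N →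
    (+ (N ^ 2) / 2) ℚ.- (C ℚ.* (+ N / 1)) ℚ.≤ + F 3 N / 1)
    × (∀ k → 4 ≤ k →
    ∃ λ (c : ℚᵘ) → ∃ λ (N₀ : ℕ) → 0ℚᵘ ℚ.< c ×
    (∀ N → N₀ ≤ N → c ℚ.* (+ (N ^ (k ∸ 1)) / 1) ℚ.≤ + F k N / 1))
theorem1p4 = F₂≡2N∸3 , (+ 5 / 1 , N²/2-CN≤F₃) , λ where
  (suc K) _ → let open LowerBound K in
    + 1 / (2 * D) ^ K , 2 * D , 0<1/m ((2 * D) ^ K) ,
    λ N 2D≤N → a≤m*b⇒a/m≤b ((2 * D) ^ K) (N^K≤[2D]^K*F N 2D≤N)
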